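{- Let $n\geq 2$, let $S_n$ be either $\Sigma_n$ or $\Sigma_n^{*}$, and let $\ell\geq 0$ be an integer. Then \[ s(B_n,S_n;\ell)=\sum_{t\in R_n(S_n,\ell)} \mathrm{card}\left(B_n(S_n,\ell,t)\right)\cdot \mathrm{card}\left(G_{S_n}\star t\right). \]
   Context: $B_n$ is the braid group, generated by $\sigma_1,\ldots,\sigma_{n-1}$ subject to $\sigma_i\sigma_j=\sigma_j\sigma_i$ for $|i-j|\geq 2$ and $\sigma_i\sigma_j\sigma_i=\sigma_j\sigma_i\sigma_j$ for $|i-j|=1$. Put $\Sigma_n=\{\sigma_i^{\pm1}\}$. For $1\leq p<q\leq n$ put $a_{p,q}=\sigma_p\cdots\sigma_{q-2}\,\sigma_{q-1}\,\sigma_{q-2}^{ -1}\cdots\sigma_p^{ -1}$, with the convention $a_{q,p}=a_{p,q}$, and $\Sigma_n^{*}=\{a_{p,q}^{\pm1}: 1\leq p<q\leq n\}$. An $S_n$-word is a finite word on the alphabet $S_n$; $\overline{u}$ is the braid represented by $u$; $|\beta|_{S_n}$ is the length of a shortest $S_n$-word representing $\beta$; $B_n(S_n,\ell)$ is the set of braids of $S_n$-length $\ell$, and $s(B_n,S_n;\ell)=\mathrm{card}(B_n(S_n,\ell))$. Permutation: $\pi:B_n\to\mathfrak{S}_n$ is the homomorphism to $(\mathfrak{S}_n,\circ)$ with $\pi(\sigma_i)=(i\ \,i{+}1)$. Linking numbers: for $i\neq j$ in $\{1,\ldots,n\}$, $\ell_{i,j}(\beta)=\ell_{j,i}(\beta)$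 is the algebraic number of crossings ($\sigma_k$ counts $+1$, $\sigma_k^{ -1}$ counts $-1$) in $\beta$ between the strands starting at positions $i$ and $j$; explicitly, if $\beta=\sigma_{k_1}^{e_1}\cdots\sigma_{k_r}^{e_r}$ and $\beta_{m}=\sigma_{k_1}^{e_1}\cdots\sigma_{k_m}^{e_m}$, then $\ell_{i,j}(\beta)$ is the sum of $e_m$ over those $m$ with $\{\pi(\beta_{m-1})(k_m),\pi(\beta_{m-1})(k_m+1)\}=\{i,j\}$ (independent of the chosen word). Template: $\tau(\beta)=(\pi(\beta),\ell_{1,2}(\beta),\ell_{1,3}(\beta),\ell_{2,3}(\beta),\ldots,\ell_{1,n}(\beta),\ldots,\ell_{n-1,n}(\beta))\in\mathfrak{S}_n\times\mathbb{Z}^{n(n-1)/2}$, the linking numbers $\ell_{i,j}$, $i<j$, being listed in co-lexicographic order of indices ($(i,j)$ before $(p,q)$ if $j<q$, or $j=q$ and $i<p$). $T_n=\tau(B_n)$, $T_n(S_n,\ell)=\tau(B_n(S_n,\ell))$, and $B_n(S_n,\ell,t)=\{\beta\in B_n(S_n,\ell):\tau(\beta)=t\}$. Action: consider the following maps on words. $\mathrm{inv}_{S_n}(x_1\cdots x_r)=x_r^{ -1}\cdots x_1^{ -1}$ on $S_n$-words; $\theta_{\Sigma_n}(x_1\cdots x_r)=x_1^{ -1}\cdots x_r^{ -1}$ on $\Sigma_n$-words; $\Phi_n$ on $\Sigma_n$-words, the letterwise map $\sigma_k^{\pm1}\mapsto\sigma_{n-k}^{\pm1}$; $\phi_n$ on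 $\Sigma_n^{*}$-words, the letterwise map $a_{p,q}^{\pm1}\mapsto a_{[p+1]_n,[q+1]_n}^{\pm1}$, where $[k]_n=k$ for $1\leq k\leq n$ and $[n+1]_n=1$. For each of these maps $\mu$, the template $\tau(\overline{\mu(u)})$ depends only on $\tau(\overline{u})$, and $\mu^T:T_n\to T_n$ denotes the induced bijection, $\mu^T(\tau(\overline{u}))=\tau(\overline{\mu(u)})$. $G_{\Sigma_n}$ is the group of bijections of $T_n$ generated by $\mathrm{inv}_{\Sigma_n}^T,\theta_{\Sigma_n}^T,\Phi_n^T$, and $G_{\Sigma_n^{*}}$ the one generated by $\mathrm{inv}_{\Sigma_n^{*}}^T,\phi_n^T$. $G_{S_n}\star t=\{g(t):g\in G_{S_n}\}$ is the orbit of $t$. Reduced templates: for $\sigma,\sigma'\in\mathfrak{S}_n$ write $\sigma<\sigma'$ if there is $k$ with $\sigma(m)=\sigma'(m)$ for all $m>k$ and $\sigma(k)<\sigma'(k)$. Templates are totally ordered lexicographically as tuples (first the permutation with this order, then the linking numbers in the order listed above). $\mathrm{red}_{S_n}(t)$ is the minimal element of $G_{S_n}\star t$; $t$ is $S_n$-reduced if $\mathrm{red}_{S_n}(t)=t$. $R_n(S_n,\ell)$ is the set of $S_n$-reduced templates lying in $T_n(S_n,\ell)$. -}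

module Defs where

open import Data.Fin.Base as Fin using (Fin; zero; suc; toℕ; inject₁; opposite)
import Data.Fin.Properties as Fin
open import Data.Fin.Permutation as Perm
  using (Permutation′; transpose; _⟨$⟩ʳ_; _∘ₚ_)
open import Data.Fin.Relation.Unary.Top using (view; ‵fromℕ; ‵inject₁)
open import Data.Integer.Base as ℤ using (ℤ; 0ℤ; _◃_)
open import Data.List.Base as List
  using (List; []; _∷_; _++_; [_]; allFin; concatMap; filter; length; map; reverse)
open import Data.Nat.Base as ℕ using (ℕ; suc; pred; ∣_-_∣)
import Data.Nat.Properties as ℕ
open import Data.Product.Base using (∃; ∃-syntax; Σ-syntax; _×_; _,_; proj₁; proj₂)
open import Data.Product.Relation.Binary.Lex.Strict using (×-Lex)
open import Data.Product.Relation.Binary.Pointwise.NonDependent using (×-setoid)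
open import Data.Sign.Base as Sign using (Sign)
open import Data.Sum.Base using (_⊎_)
open import Data.Vec.Base as Vec using (Vec)
import Data.Vec.Relation.Binary.Lex.Strict as Vec
open import Function.Bundles using (Inverse)
open import Level using (0ℓ)
open import Relation.Binary.Bundles using (Setoid)
open import Relation.Binary.Construct.Closure.Equivalence as EqClosure using (EqClosure)
import Relation.Binary.Construct.On as On
open import Relation.Binary.Core using (Rel)
open import Relation.Binary.Definitions using (tri<; tri≈; tri>)
open import Relation.Binary.PropositionalEquality.Core using (_≡_; _≢_; refl; cong)
open import Relation.Binary.PropositionalEquality using (_→-setoid_)
import Relation.Binary.PropositionalEquality.Properties as ≡
open import Relation.Nullary using (Dec; does; contradiction)
open import Relation.Nullary.Decidable using (_×-dec_; _⊎-dec_)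
open import Relation.Unary using (Pred)
open import Data.Bool.Base using (if_then_else_)

private
  variable
    n : ℕ
    A B : Set

------------------------------------------------------------------------
-- Words

Letter : Set → Set
Letter A = A × Sign

Word : Set → Set
Word A = List (Letter A)

_⁻¹ : Letter A → Letter A
(a , s) ⁻¹ = a , Sign.opposite s

letterwise : (A → B) → Word A → Word B
letterwise f = map λ (a , s) → f a , s

inv : Word A → Word A
inv u = reverse (map _⁻¹ u)

------------------------------------------------------------------------
-- The braid group

-- Strands and positions 1, …, n are the elements of Fin n, so everything is
-- shifted by one: k : Fin (pred n) stands for the generator σ₍ₖ₊₁₎, which
-- exchanges the positions  lo k  and  hi k.

data Artin (n : ℕ) : Set where
  artin : Fin (pred n) → Artin n

lo hi : Artin n → Fin n
lo {suc n} (artin k) = inject₁ k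
hi {suc n} (artin k) = suc k

σ : Fin (pred n) → Letter (Artin n)
σ k = artin k , Sign.+

data Relator {n} : Rel (Word (Artin n)) 0ℓ where
  cancel : (x : Letter (Artin n)) → Relator (x ∷ x ⁻¹ ∷ []) []
  far    : ∀ i j → 2 ℕ.≤ ∣ toℕ i - toℕ j ∣ →
           Relator (σ i ∷ σ j ∷ []) (σ j ∷ σ i ∷ [])
  near   : ∀ i j → ∣ toℕ i - toℕ j ∣ ≡ 1 →
           Relator (σ i ∷ σ j ∷ σ i ∷ []) (σ j ∷ σ i ∷ σ j ∷ [])

data Step {n} : Rel (Word (Artin n)) 0ℓ where
  step : ∀ u {l r} v → Relator l r → Step (u ++ l ++ v) (u ++ r ++ v)

-- Braids are represented by words in the σᵢ; equality of braids is the
-- equality of this setoid.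
braidSetoid : ℕ → Setoid 0ℓ 0ℓ
braidSetoid n = EqClosure.setoid (Step {n})

infix 4 _≈ᵇ_
_≈ᵇ_ : Rel (Word (Artin n)) 0ℓ
_≈ᵇ_ {n} = Setoid._≈_ (braidSetoid n)

-- The generators a_{p,q}, p < q.
data Band (n : ℕ) : Set where
  a⟨_,_,_⟩ : (p q : Fin n) → p Fin.< q → Band n

-- a_{p,q} = c σ_{q-1} c⁻¹  with  c = σ_p ⋯ σ_{q-2}.
bandWord : Band n → Word (Artin n)
bandWord {suc m} a⟨ p , suc q , _ ⟩ = c ++ [ σ q ] ++ inv c
  where
  c : Word (Artin (suc m))
  c = map σ (filter (λ k → (toℕ p ℕ.≤? toℕ k) ×-dec (toℕ k ℕ.<? toℕ q)) (allFin m))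

data Alphabet : Set where
  Σₙ Σₙ* : Alphabet

Gen : Alphabet → ℕ → Set
Gen Σₙ  = Artin
Gen Σₙ* = Band

expand : ∀ S → Word (Gen S n) → Word (Artin n)
expand Σₙ  u = u
expand Σₙ* u = concatMap expandLetter u
  where
  expandLetter : Letter (Band n) → Word (Artin n)
  expandLetter (a , Sign.+) = bandWord a
  expandLetter (a , Sign.-) = inv (bandWord a)

-- |β|_S = ℓ
HasLength : ∀ S → Word (Artin n) → ℕ → Set
HasLength {n} S β ℓ =
    (Σ[ u ∈ Word (Gen S n) ] expand S u ≈ᵇ β × length u ≡ ℓ)
  × (∀ (u : Word (Gen S n)) → expand S u ≈ᵇ β → ℓ ℕ.≤ length u)

------------------------------------------------------------------------
-- Templates

πLetter : Letter (Artin n) → Permutation′ n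
πLetter (k , _) = transpose (lo k) (hi k)

-- ρ ∘ₚ ρ′ applies ρ first, so π (u v) = π u ∘ π v as functions.
π : Word (Artin n) → Permutation′ n
π []      = Perm.id
π (x ∷ u) = π u ∘ₚ πLetter x

-- {a , b} = {i , j}
samePair? : (a b i j : Fin n) → Dec ((a ≡ i × b ≡ j) ⊎ (a ≡ j × b ≡ i))
samePair? a b i j =
  ((a Fin.≟ i) ×-dec (b Fin.≟ j)) ⊎-dec ((a Fin.≟ j) ×-dec (b Fin.≟ i))

-- The argument ρ is the permutation of the part of the word already read.
linkingFrom : Permutation′ n → Word (Artin n) → Fin n → Fin n → ℤ
linkingFrom ρ []            i j = 0ℤ
linkingFrom ρ ((k , s) ∷ u) i j =
  (if does (samePair? (ρ ⟨$⟩ʳ lo k) (ρ ⟨$⟩ʳ hi k) i j) then s ◃ 1 else 0ℤ)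
  ℤ.+ linkingFrom (πLetter (k , s) ∘ₚ ρ) u i j

linking : Word (Artin n) → Fin n → Fin n → ℤ
linking = linkingFrom Perm.id

-- All (i , j) with i < j, in co-lexicographic order.
pairs : ∀ n → List (Fin n × Fin n)
pairs n = concatMap (λ j → map (_, j) (filter (Fin._<? j) (allFin n))) (allFin n)

permutationSetoid : ℕ → Setoid 0ℓ 0ℓ
permutationSetoid n = record
  { Carrier       = Permutation′ n
  ; _≈_           = Perm._≈_
  ; isEquivalence = On.isEquivalence _⟨$⟩ʳ_ (Setoid.isEquivalence (Fin n →-setoid Fin n))
  }

templateSetoid : ℕ → Setoid 0ℓ 0ℓ
templateSetoid n =
  ×-setoid (permutationSetoid n) (≡.setoid (Vec ℤ (length (pairs n))))

Template : ℕ → Set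
Template n = Setoid.Carrier (templateSetoid n)

infix 4 _≈ᵗ_
_≈ᵗ_ : Rel (Template n) 0ℓ
_≈ᵗ_ {n} = Setoid._≈_ (templateSetoid n)

τ : Word (Artin n) → Template n
τ {n} u = π u , Vec.map (λ (i , j) → linking u i j) (Vec.fromList (pairs n))

-- T_n
InT : Pred (Template n) 0ℓ
InT t = ∃[ u ] τ u ≈ᵗ t

------------------------------------------------------------------------
-- The action on templates

-- [ k + 1 ]ₙ
rotate : Fin n → Fin n
rotate {suc n} k with view k
... | ‵fromℕ     = zero
... | ‵inject₁ i = suc i

rotate-injective : (p q : Fin n) → rotate p ≡ rotate q → p ≡ q
rotate-injective {suc n} p q eq with view p | view q
... | ‵fromℕ     | ‵fromℕ     = refl
... | ‵inject₁ i | ‵inject₁ j = cong inject₁ (Fin.suc-injective eq)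

-- a_{p,q} for p ≠ q, with the convention a_{q,p} = a_{p,q}.
band : (p q : Fin n) → p ≢ q → Band n
band p q p≢q with Fin.<-cmp p q
... | tri< p<q _   _   = a⟨ p , q , p<q ⟩
... | tri≈ _   p≡q _   = contradiction p≡q p≢q
... | tri> _   _   q<p = a⟨ q , p , q<p ⟩

rotateBand : Band n → Band n
rotateBand a⟨ p , q , p<q ⟩ =
  band (rotate p) (rotate q) λ eq → Fin.<⇒≢ p<q (rotate-injective p q eq)

-- σ_k ↦ σ_{n-k}
flipArtin : Artin n → Artin n
flipArtin (artin k) = artin (opposite k)

data WordMap : Alphabet → Set where
  invᵂ  : ∀ {S} → WordMap S
  θᵂ Φᵂ : WordMap Σₙ
  φᵂ    : WordMap Σₙ*

apply : ∀ {S} → WordMap S → Word (Gen S n) → Word (Gen S n)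
apply invᵂ = inv
apply θᵂ   = map _⁻¹
apply Φᵂ   = letterwise flipArtin
apply φᵂ   = letterwise rotateBand

-- Bijections of T_n are given by their graphs; this is the graph
-- { (τ(ū) , τ(μ(u)‾)) } of μᵀ.
Induced : ∀ {S} → WordMap S → Rel (Template n) 0ℓ
Induced {n} {S} μ t t′ =
  Σ[ u ∈ Word (Gen S n) ] τ (expand S u) ≈ᵗ t × τ (expand S (apply μ u)) ≈ᵗ t′

-- The group G_S generated by the μᵀ: its elements are named by formal
-- products of generators and inverses, and ⟦ g ⟧ is the graph of g.
data G (S : Alphabet) : Set where
  gen  : WordMap S → G S
  one  : G S
  _∙_  : G S → G S → G S
  _⁻¹ᴳ : G S → G S

⟦_⟧ : ∀ {S} → G S → Rel (Template n) 0ℓ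
⟦ gen μ  ⟧ t t′ = Induced μ t t′
⟦ one    ⟧ t t′ = InT t × t ≈ᵗ t′
⟦ g ∙ h  ⟧ t t′ = ∃[ t″ ] ⟦ h ⟧ t t″ × ⟦ g ⟧ t″ t′
⟦ g ⁻¹ᴳ  ⟧ t t′ = ⟦ g ⟧ t′ t

Orbit : Alphabet → Template n → Pred (Template n) 0ℓ
Orbit S t t′ = ∃[ g ] ⟦_⟧ {S = S} g t t′

------------------------------------------------------------------------
-- Reduced templates

infix 4 _<ᵖ_ _≤ᵗ_

_<ᵖ_ : Rel (Permutation′ n) 0ℓ
ρ <ᵖ ρ′ = ∃[ k ] (∀ m → k Fin.< m → ρ ⟨$⟩ʳ m ≡ ρ′ ⟨$⟩ʳ m) × ρ ⟨$⟩ʳ k Fin.< ρ′ ⟨$⟩ʳ k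

_≤ᵗ_ : Rel (Template n) 0ℓ
_≤ᵗ_ = ×-Lex Perm._≈_ _<ᵖ_ (Vec.Lex-≤ _≡_ ℤ._<_)

-- red_S(t) = r
IsRed : Alphabet → Template n → Template n → Set
IsRed S t r = Orbit S t r × (∀ t′ → Orbit S t t′ → r ≤ᵗ t′)

Reduced : Alphabet → Pred (Template n) 0ℓ
Reduced S t = IsRed S t t

------------------------------------------------------------------------
-- The sets being counted

_∣ˢ_ : (X : Setoid 0ℓ 0ℓ) → Pred (Setoid.Carrier X) 0ℓ → Setoid 0ℓ 0ℓ
X ∣ˢ P = On.setoid {B = ∃ P} X proj₁

-- card X = k
HasCard : Setoid 0ℓ 0ℓ → ℕ → Set
HasCard X k = Inverse (≡.setoid (Fin k)) X

-- B_n(S,ℓ)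
braidsOfLength : ∀ n → Alphabet → ℕ → Setoid 0ℓ 0ℓ
braidsOfLength n S ℓ = braidSetoid n ∣ˢ λ β → HasLength S β ℓ

-- B_n(S,ℓ,t)
braidsWithTemplate : ∀ n → Alphabet → ℕ → Template n → Setoid 0ℓ 0ℓ
braidsWithTemplate n S ℓ t = braidSetoid n ∣ˢ λ β → HasLength S β ℓ × τ β ≈ᵗ t

-- t ∈ T_n(S,ℓ)
InTOfLength : Alphabet → ℕ → Pred (Template n) 0ℓ
InTOfLength S ℓ t = ∃[ β ] HasLength S β ℓ × τ β ≈ᵗ t

-- R_n(S,ℓ)
reducedTemplates : ∀ n → Alphabet → ℕ → Setoid 0ℓ 0ℓ
reducedTemplates n S ℓ = templateSetoid n ∣ˢ λ t → Reduced S t × InTOfLength S ℓ t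

-- G_S ⋆ t
orbit : ∀ n → Alphabet → Template n → Setoid 0ℓ 0ℓ
orbit n S t = templateSetoid n ∣ˢ Orbit S t

-- The cardinalities occurring in the counting formula, together with an
-- enumeration of R_n(S,ℓ) to sum over. Each number is uniquely determined by
-- the set it counts.
record Cardinalities (n : ℕ) (S : Alphabet) (ℓ : ℕ) : Set where
  field
    s      : ℕ
    s-card : HasCard (braidsOfLength n S ℓ) s
    r      : ℕ
    r-card : HasCard (reducedTemplates n S ℓ) r

  red : Fin r → Template n
  red i = proj₁ (Inverse.to r-card i)

  field
    b      : Fin r → ℕ
    b-card : ∀ i → HasCard (braidsWithTemplate n S ℓ (red i)) (b i)
    o      : Fin r → ℕ
    o-card : ∀ i → HasCard (orbit n S (red i)) (o i)

{-# OPTIONS --safe #-}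

-- Every generator of G_S comes from a length-preserving bijection of the braid
-- group which is compatible with τ: inversion, the automorphisms
-- σ_k ↦ σ_k⁻¹ and σ_k ↦ σ_{n-k}, and conjugation by δ = σ₁ ⋯ σ_{n-1}, which
-- maps a_{p,q} to a_{p+1,q+1}. Hence all the sets B_n(S,ℓ,t) with t in a given
-- orbit have the same cardinality, and every orbit meeting T_n(S,ℓ) contains
-- exactly one reduced template. Finiteness of all the sets involved holds only
-- up to double negation, because the word problem is not decided here; the
-- formula itself is an equation in ℕ, hence stable.

module Submission where

open import Defs
open import Algebra.Bundles using (Group)
import Algebra.Properties.Group as GroupProperties
open import Data.Bool.Base using (if_then_else_; true; false)
open import Data.Fin.Base as Fin
  using (Fin; zero; suc; toℕ; inject₁; fromℕ; fromℕ<; opposite; punchOut; splitAt; _↑ˡ_; _↑ʳ_; combine)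
import Data.Fin.Permutation as Perm
open import Data.Fin.Permutation using (Permutation′; _⟨$⟩ʳ_; _⟨$⟩ˡ_; _∘ₚ_)
open import Data.Fin.Permutation.Components using (transpose; transpose-inverse)
import Data.Fin.Properties as Fin
open import Data.Fin.Relation.Unary.Top using (view; view-fromℕ; view-inject₁; ‵fromℕ; ‵inject₁)
open import Data.Integer.Base as ℤ using (ℤ; 0ℤ; _◃_; _+_; -_)
import Data.Integer.Properties as ℤ
open import Data.Integer.Tactic.RingSolver using (solve-∀)
open import Data.List.Base
  using (List; []; _∷_; _++_; [_]; map; reverse; length; allFin; filter; tabulate)
open import Data.List.Membership.Propositional using (_∈_)
open import Data.List.Membership.Propositional.Properties
  using (∈-concatMap⁺; ∈-map⁺; ∈-filter⁺; ∈-allFin)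
open import Data.List.Properties as List using (++-assoc; ++-identityʳ; unfold-reverse)
import Data.List.Relation.Unary.All as All
open import Data.List.Relation.Unary.Any as Any using (here; there)
open import Data.Nat.Base as ℕ
  using (ℕ; suc; pred; _*_; _^_; _≤_; _<_; _≥_; s≤s; z≤n; ∣_-_∣)
open import Data.Nat.ListAction using (sum)
import Data.Nat.Properties as ℕ
open import Data.Product.Base as Product
  using (_×_; _,_; proj₁; proj₂; ∃; Σ; ∃-syntax; Σ-syntax)
open import Data.Product.Relation.Binary.Lex.Strict
  using (×-transitive; ×-total₂; ×-antisymmetric)
open import Data.Sign.Base as Sign using (Sign)
import Data.Sign.Properties as Sign
open import Data.Sum.Base as Sum using (_⊎_; inj₁; inj₂; [_,_]′)
import Data.Vec.Base as Vec
import Data.Vec.Properties as Vec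
import Data.Vec.Relation.Binary.Lex.Strict as Vec
import Data.Vec.Relation.Binary.Pointwise.Inductive as Pointwise
open import Function.Base using (_∘_; id)
open import Function.Bundles using (Inverse; mk⇔)
open import Level using (Level; 0ℓ)
open import Relation.Binary.Bundles using (Setoid)
import Relation.Binary.Construct.Closure.Equivalence as EqClosure
open import Relation.Binary.Core using (Rel)
open import Relation.Binary.Definitions
  using (tri<; tri≈; tri>; Total; Transitive; Asymmetric; Trichotomous; _Respects₂_)
import Relation.Binary.Reasoning.Setoid as SetoidReasoning
open import Relation.Binary.PropositionalEquality
  using (_≡_; _≢_; refl; sym; trans; cong; cong₂; subst; subst₂; resp₂; isEquivalence; module ≡-Reasoning)
open import Relation.Binary.Structures using (IsEquivalence)
open import Relation.Nullary using (¬_; Dec; yes; no; does; contradiction)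
open import Relation.Nullary.Decidable
  using (_×-dec_; does-⇔; dec-true; dec-false; decidable-stable; ¬¬-excluded-middle)
open import Relation.Unary using (Pred; Decidable)

-- The sum is obtained from one bijection: the disjoint union, over the reduced templates, of the
-- products of B_n(S,ℓ,red) with the orbit of red is mapped onto B_n(S,ℓ). A pair (β, t) goes to g
-- β, where g is the group element that witnesses t in the orbit. Each enumerated orbit point
-- carries one such g, so stabilisers never enter. Group elements are given only as graphs on
-- templates. Each formal product is therefore also realised as a bijection of braids, and its graph
-- is shown to be the trace of this bijection on templates. This needs every generator to respect
-- equality of templates. That equality is a congruence on words under which letters cancel, so
-- inversion and conjugation respect it for formal reasons; only θ and Φ require a computation of
-- linking numbers. For the rotation of bands, the obstacle is a band that ends at the last strand:
-- its image wraps around, and conjugation by δ does more there than shift indices.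

private
  variable
    ℓ₁ ℓ₂ : Level
    A B : Set
    m n k : ℕ


-- Words and the braid group

⁻¹-involutive : (x : Letter A) → (x ⁻¹) ⁻¹ ≡ x
⁻¹-involutive (a , s) = cong (a ,_) (Sign.opposite-selfInverse refl)

inv-∷ : (x : Letter A) (u : Word A) → inv (x ∷ u) ≡ inv u ++ [ x ⁻¹ ]
inv-∷ x u = unfold-reverse (x ⁻¹) (map _⁻¹ u)

inv-++ : (u v : Word A) → inv (u ++ v) ≡ inv v ++ inv u
inv-++ u v = trans (cong reverse (List.map-++ _⁻¹ u v)) (List.reverse-++ (map _⁻¹ u) (map _⁻¹ v))

inv-involutive : (u : Word A) → inv (inv u) ≡ u
inv-involutive []      = refl
inv-involutive (x ∷ u) = begin
  inv (inv (x ∷ u))             ≡⟨ cong inv (inv-∷ x u) ⟩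
  inv (inv u ++ [ x ⁻¹ ])       ≡⟨ inv-++ (inv u) [ x ⁻¹ ] ⟩
  (x ⁻¹) ⁻¹ ∷ inv (inv u)       ≡⟨ cong₂ _∷_ (⁻¹-involutive x) (inv-involutive u) ⟩
  x ∷ u                         ∎
  where open ≡-Reasoning

length-inv : (u : Word A) → length (inv u) ≡ length u
length-inv u = trans (List.length-reverse (map _⁻¹ u)) (List.length-map _⁻¹ u)

-- Words modulo any congruence that cancels letters form a group. Kept abstract because it is
-- applied twice, to equality of braids and to equality of templates; in both cases compatibility
-- with inversion comes for free.
module Congruence (_≈_ : Rel (Word A) 0ℓ) (isEquivalence : IsEquivalence _≈_)
  (∙-cong : ∀ {u u′ v v′} → u ≈ u′ → v ≈ v′ → (u ++ v) ≈ (u′ ++ v′))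
  (cancels : ∀ x → (x ∷ x ⁻¹ ∷ []) ≈ []) where

  private
    setoid : Setoid 0ℓ 0ℓ
    setoid = record { isEquivalence = isEquivalence }

    module E = Setoid setoid

  open SetoidReasoning setoid

  inverseʳ : ∀ u → (u ++ inv u) ≈ []
  inverseʳ []      = E.refl
  inverseʳ (x ∷ u) = begin
    x ∷ u ++ inv (x ∷ u)             ≡⟨ cong (λ w → x ∷ u ++ w) (inv-∷ x u) ⟩
    x ∷ u ++ inv u ++ [ x ⁻¹ ]       ≡⟨ cong (x ∷_) (++-assoc u (inv u) _) ⟨
    [ x ] ++ (u ++ inv u) ++ [ x ⁻¹ ] ≈⟨ ∙-cong (E.refl {[ x ]}) (∙-cong (inverseʳ u) E.refl) ⟩
    x ∷ x ⁻¹ ∷ []                    ≈⟨ cancels x ⟩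
    []                               ∎

  inverseˡ : ∀ u → (inv u ++ u) ≈ []
  inverseˡ u = begin
    inv u ++ u             ≡⟨ cong (inv u ++_) (inv-involutive u) ⟨
    inv u ++ inv (inv u)   ≈⟨ inverseʳ (inv u) ⟩
    []                     ∎

  -- Uniqueness of inverses: `inv u ++ v ++ inv v` collapses from either end once `v` is traded for
  -- `u`.
  inv-cong : ∀ {u v} → u ≈ v → inv u ≈ inv v
  inv-cong {u} {v} u≈v = begin
    inv u                  ≡⟨ ++-identityʳ (inv u) ⟨
    inv u ++ []            ≈⟨ ∙-cong (E.refl {inv u}) (inverseʳ v) ⟨
    inv u ++ v ++ inv v    ≈⟨ ∙-cong (E.refl {inv u}) (∙-cong u≈v E.refl) ⟨
    inv u ++ u ++ inv v    ≡⟨ ++-assoc (inv u) u (inv v) ⟨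
    (inv u ++ u) ++ inv v  ≈⟨ ∙-cong (inverseˡ u) E.refl ⟩
    inv v                  ∎

  group : Group 0ℓ 0ℓ
  group = record
    { Carrier = Word A
    ; _≈_     = _≈_
    ; _∙_     = _++_
    ; ε       = []
    ; _⁻¹     = inv
    ; isGroup = record
      { isMonoid = record
        { isSemigroup = record
          { isMagma = record { isEquivalence = isEquivalence ; ∙-cong = ∙-cong }
          ; assoc   = λ u v w → E.reflexive (++-assoc u v w)
          }
        ; identity = (λ _ → E.refl) , λ u → E.reflexive (++-identityʳ u)
        }
      ; inverse = inverseˡ , inverseʳ
      ; ⁻¹-cong = inv-cong
      }
    }

relator : {l r : Word (Artin n)} → Relator l r → l ≈ᵇ r
relator {l = l} {r} ρ =
  EqClosure.return (subst₂ Step (++-identityʳ l) (++-identityʳ r) (step [] [] ρ))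

++-congˡ : (w : Word (Artin n)) {u v : Word (Artin n)} → u ≈ᵇ v → (w ++ u) ≈ᵇ (w ++ v)
++-congˡ {n} w = EqClosure.gmap (w ++_) prepend
  where
  prepend : ∀ {u v} → Step {n} u v → Step (w ++ u) (w ++ v)
  prepend (step u {l} {r} v ρ)
    rewrite sym (++-assoc w u (l ++ v)) | sym (++-assoc w u (r ++ v)) = step (w ++ u) v ρ

++-congʳ : (w : Word (Artin n)) {u v : Word (Artin n)} → u ≈ᵇ v → (u ++ w) ≈ᵇ (v ++ w)
++-congʳ {n} w = EqClosure.gmap (_++ w) append
  where
  assoc₃ : ∀ u l v → (u ++ l ++ v) ++ w ≡ u ++ l ++ v ++ w
  assoc₃ u l v = trans (++-assoc u (l ++ v) w) (cong (u ++_) (++-assoc l v w))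

  append : ∀ {u v} → Step {n} u v → Step (u ++ w) (v ++ w)
  append (step u {l} {r} v ρ) rewrite assoc₃ u l v | assoc₃ u r v = step u (v ++ w) ρ

module ≈ᵇ {n : ℕ} = Setoid (braidSetoid n)

++-cong : {u u′ v v′ : Word (Artin n)} → u ≈ᵇ u′ → v ≈ᵇ v′ → (u ++ v) ≈ᵇ (u′ ++ v′)
++-cong {u′ = u′} {v} p q = ≈ᵇ.trans (++-congʳ v p) (++-congˡ u′ q)

cancels : (x : Letter (Artin n)) → (x ∷ x ⁻¹ ∷ []) ≈ᵇ []
cancels x = relator (cancel x)

module Braid {n : ℕ} = Congruence (_≈ᵇ_ {n}) ≈ᵇ.isEquivalence ++-cong cancels

-- The universal property of the presentation, with values in words modulo a congruence. With `_∼_`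
-- as target it makes templates invariants of braids; with `_≈ᵇ_` it yields the automorphisms θ and
-- Φ.
module _ {m n : ℕ} (_≈_ : Rel (Word (Artin m)) 0ℓ) (isEquivalence : IsEquivalence _≈_)
  (∙-cong : ∀ {u u′ v v′} → u ≈ u′ → v ≈ v′ → (u ++ v) ≈ (u′ ++ v′))
  (f : Word (Artin n) → Word (Artin m))
  (f-++ : ∀ u v → f (u ++ v) ≡ f u ++ f v)
  (f-relator : ∀ {l r} → Relator l r → f l ≈ f r) where

  private
    module E = IsEquivalence isEquivalence

    f-step : ∀ {u v} → Step u v → f u ≈ f v
    f-step (step u {l} {r} v ρ)
      rewrite f-++ u (l ++ v) | f-++ u (r ++ v) | f-++ l v | f-++ r v =
      ∙-cong (E.refl {f u}) (∙-cong (f-relator ρ) (E.refl {f v}))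

  extend : ∀ {u v} → u ≈ᵇ v → f u ≈ f v
  extend = EqClosure.gfold isEquivalence f f-step

-- Templates

transpose-ˡ : (a b : Fin n) → transpose a b a ≡ b
transpose-ˡ a b rewrite dec-true (a Fin.≟ a) refl = refl

transpose-ʳ : (a b : Fin n) → transpose a b b ≡ a
transpose-ʳ a b with b Fin.≟ a
... | yes b≡a = b≡a
... | no  _   rewrite dec-true (b Fin.≟ b) refl = refl

transpose-fix : (a b : Fin n) {x : Fin n} → x ≢ a → x ≢ b → transpose a b x ≡ x
transpose-fix a b {x} x≢a x≢b
  rewrite dec-false (x Fin.≟ a) x≢a | dec-false (x Fin.≟ b) x≢b = refl

transpose-conjugate : (f : Fin n → Fin n) → (∀ {x y} → f x ≡ f y → x ≡ y) →
                      ∀ a b x → f (transpose a b x) ≡ transpose (f a) (f b) (f x)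
transpose-conjugate f f-injective a b x with x Fin.≟ a
... | yes refl = sym (transpose-ˡ (f a) (f b))
... | no  x≢a with x Fin.≟ b
...   | yes refl = sym (transpose-ʳ (f a) (f b))
...   | no  x≢b  = sym (transpose-fix (f a) (f b) (x≢a ∘ f-injective) (x≢b ∘ f-injective))

transpose-comm : (a b x : Fin n) → transpose a b x ≡ transpose b a x
transpose-comm a b x = by-cases (x Fin.≟ a) (x Fin.≟ b)
  where
  by-cases : Dec (x ≡ a) → Dec (x ≡ b) → transpose a b x ≡ transpose b a x
  by-cases (yes refl) _          = trans (transpose-ˡ a b) (sym (transpose-ʳ b a))
  by-cases (no _)     (yes refl) = trans (transpose-ʳ a b) (sym (transpose-ˡ b a))
  by-cases (no x≢a)   (no x≢b)   = trans (transpose-fix a b x≢a x≢b) (sym (transpose-fix b a x≢b x≢a))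

-- Has literally the shape of the summand in `linkingFrom`, so the two can be compared letter by
-- letter.
crossing : (a b : Fin n) → Sign → (i j : Fin n) → ℤ
crossing a b s i j = if does (samePair? a b i j) then s ◃ 1 else 0ℤ

crossing-cong : (s : Sign) (a b i j a′ b′ i′ j′ : Fin n) →
                ((a ≡ i × b ≡ j) ⊎ (a ≡ j × b ≡ i) → (a′ ≡ i′ × b′ ≡ j′) ⊎ (a′ ≡ j′ × b′ ≡ i′)) →
                ((a′ ≡ i′ × b′ ≡ j′) ⊎ (a′ ≡ j′ × b′ ≡ i′) → (a ≡ i × b ≡ j) ⊎ (a ≡ j × b ≡ i)) →
                crossing a b s i j ≡ crossing a′ b′ s i′ j′
crossing-cong s a b i j a′ b′ i′ j′ f g =
  cong (λ c → if c then s ◃ 1 else 0ℤ) (does-⇔ (mk⇔ f g) (samePair? a b i j) (samePair? a′ b′ i′ j′))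

crossing-equivariant : (f : Fin n → Fin n) → (∀ {x y} → f x ≡ f y → x ≡ y) →
                       ∀ a b s i j → crossing (f a) (f b) s (f i) (f j) ≡ crossing a b s i j
crossing-equivariant f inj a b s i j = crossing-cong s _ _ _ _ a b i j
  (Sum.map (Product.map inj inj) (Product.map inj inj))
  (Sum.map (Product.map (cong f) (cong f)) (Product.map (cong f) (cong f)))

crossing-swap : ∀ (a b : Fin n) s i j → crossing a b s i j ≡ crossing b a s i j
crossing-swap a b s i j = crossing-cong s a b i j b a i j
  (Sum.swap ∘ Sum.map Product.swap Product.swap) (Sum.swap ∘ Sum.map Product.swap Product.swap)

crossing-sym : ∀ (a b : Fin n) s i j → crossing a b s i j ≡ crossing a b s j i
crossing-sym a b s i j = crossing-cong s a b i j a b j i Sum.swap Sum.swap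

crossing-diagonal : ∀ {a b : Fin n} s i → a ≢ b → crossing a b s i i ≡ 0ℤ
crossing-diagonal {a = a} {b} s i a≢b =
  cong (λ c → if c then s ◃ 1 else 0ℤ) (dec-false (samePair? a b i i) a≁b)
  where
  a≁b : ¬ ((a ≡ i × b ≡ i) ⊎ (a ≡ i × b ≡ i))
  a≁b (inj₁ (refl , refl)) = a≢b refl
  a≁b (inj₂ (refl , refl)) = a≢b refl

crossing-opposite : ∀ (a b : Fin n) s i j → crossing a b (Sign.opposite s) i j ≡ - crossing a b s i j
crossing-opposite a b s i j with does (samePair? a b i j) | s
... | true  | Sign.+ = refl
... | true  | Sign.- = refl
... | false | _      = refl

-- The arguments stand in the order of the inverse half of `πLetter`; thus `strand ((k , s) ∷ u) i`
-- reduces to `strand u (swapAt k i)`.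
swapAt : Artin n → Fin n → Fin n
swapAt k = transpose (hi k) (lo k)

lo≢hi : (k : Artin n) → lo k ≢ hi k
lo≢hi {suc n} (artin k) lo≡hi = ℕ.1+n≢n (sym (trans (sym (Fin.toℕ-inject₁ k)) (cong toℕ lo≡hi)))

swapAt-involutive : (k : Artin n) (x : Fin n) → swapAt k (swapAt k x) ≡ x
swapAt-involutive k x =
  trans (transpose-comm (hi k) (lo k) (swapAt k x)) (transpose-inverse (lo k) (hi k) {x})

swapAt-injective : (k : Artin n) {x y : Fin n} → swapAt k x ≡ swapAt k y → x ≡ y
swapAt-injective k {x} {y} eq =
  trans (sym (swapAt-involutive k x)) (trans (cong (swapAt k) eq) (swapAt-involutive k y))

-- The linking numbers once more: removing the first letter renumbers the strands.
link : Word (Artin n) → Fin n → Fin n → ℤ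
link []            i j = 0ℤ
link ((k , s) ∷ u) i j = crossing (lo k) (hi k) s i j + link u (swapAt k i) (swapAt k j)

-- Instead of pushing positions forward to strand labels by `ρ`, the labels `i` and `j` are pulled
-- back to their current positions. As `ρ` is bijective, the same letters are counted.
linkingFrom≡link : (ρ : Permutation′ n) (u : Word (Artin n)) (i j : Fin n) →
                   linkingFrom ρ u i j ≡ link u (ρ ⟨$⟩ˡ i) (ρ ⟨$⟩ˡ j)
linkingFrom≡link ρ []            i j = refl
linkingFrom≡link ρ ((k , s) ∷ u) i j = cong₂ _+_
  (crossing-cong s _ _ i j (lo k) (hi k) _ _
    (Sum.map (Product.map to to) (Product.map to to))
    (Sum.map (Product.map from from) (Product.map from from)))
  (linkingFrom≡link (πLetter (k , s) ∘ₚ ρ) u i j)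
  where
  to : ∀ {x y} → ρ ⟨$⟩ʳ x ≡ y → x ≡ ρ ⟨$⟩ˡ y
  to refl = sym (Perm.inverseˡ ρ)

  from : ∀ {x y} → x ≡ ρ ⟨$⟩ˡ y → ρ ⟨$⟩ʳ x ≡ y
  from refl = Perm.inverseʳ ρ

-- `π` sends final positions to starting positions, so its inverse gives the final position of the
-- strand that starts at `i`.
strand : Word (Artin n) → Fin n → Fin n
strand u i = π u ⟨$⟩ˡ i

strand-++ : (u v : Word (Artin n)) (i : Fin n) → strand (u ++ v) i ≡ strand v (strand u i)
strand-++ []            v i = refl
strand-++ ((k , s) ∷ u) v i = strand-++ u v (swapAt k i)

-- A cocycle rule: the second word meets the strands where the first has left them. This is why
-- linking numbers alone give no congruence, but linking numbers together with strands do.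
link-++ : (u v : Word (Artin n)) (i j : Fin n) →
          link (u ++ v) i j ≡ link u i j + link v (strand u i) (strand u j)
link-++ []            v i j = sym (ℤ.+-identityˡ _)
link-++ ((k , s) ∷ u) v i j =
  trans (cong (crossing (lo k) (hi k) s i j +_) (link-++ u v (swapAt k i) (swapAt k j)))
        (sym (ℤ.+-assoc (crossing (lo k) (hi k) s i j) _ _))

link-sym : (u : Word (Artin n)) (i j : Fin n) → link u i j ≡ link u j i
link-sym []            i j = refl
link-sym ((k , s) ∷ u) i j = cong₂ _+_ (crossing-sym (lo k) (hi k) s i j) (link-sym u _ _)

-- A template records only the pairs `i < j`; together with `link-sym` this recovers the remaining
-- ones.
link-diagonal : (u : Word (Artin n)) (i : Fin n) → link u i i ≡ 0ℤ
link-diagonal []            i = refl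
link-diagonal ((k , s) ∷ u) i = cong₂ _+_ (crossing-diagonal s i (lo≢hi k)) (link-diagonal u _)

-- Equality of templates as a congruence on words

infix 4 _∼_

-- The kernel of `τ`, in a form suited to induction on words: inverse permutations in place of
-- permutations, and linking numbers of all pairs in place of a vector. The equivalence is `∼⇒≈ᵗ`
-- and `≈ᵗ⇒∼`.
record _∼_ (u v : Word (Artin n)) : Set where
  constructor _,_
  field
    strands : ∀ i → strand u i ≡ strand v i
    links   : ∀ i j → link u i j ≡ link v i j

∼-isEquivalence : IsEquivalence (_∼_ {n})
∼-isEquivalence = record
  { refl  = (λ _ → refl) , (λ _ _ → refl)
  ; sym   = λ (p , q) → (λ i → sym (p i)) , (λ i j → sym (q i j))
  ; trans = λ (p , q) (p′ , q′) → (λ i → trans (p i) (p′ i)) , (λ i j → trans (q i j) (q′ i j))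
  }

∼-++-cong : {u u′ v v′ : Word (Artin n)} → u ∼ u′ → v ∼ v′ → (u ++ v) ∼ (u′ ++ v′)
∼-++-cong {u = u} {u′} {v} {v′} (p , q) (p′ , q′) = strands , links
  where
  open ≡-Reasoning

  strands : ∀ i → strand (u ++ v) i ≡ strand (u′ ++ v′) i
  strands i = begin
    strand (u ++ v) i       ≡⟨ strand-++ u v i ⟩
    strand v (strand u i)   ≡⟨ p′ (strand u i) ⟩
    strand v′ (strand u i)  ≡⟨ cong (strand v′) (p i) ⟩
    strand v′ (strand u′ i) ≡⟨ strand-++ u′ v′ i ⟨
    strand (u′ ++ v′) i     ∎

  links : ∀ i j → link (u ++ v) i j ≡ link (u′ ++ v′) i j
  links i j = begin
    link (u ++ v) i j                                  ≡⟨ link-++ u v i j ⟩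
    link u i j + link v (strand u i) (strand u j)      ≡⟨ cong₂ _+_ (q i j) (q′ _ _) ⟩
    link u′ i j + link v′ (strand u i) (strand u j)    ≡⟨ cong₂ (λ x y → link u′ i j + link v′ x y) (p i) (p j) ⟩
    link u′ i j + link v′ (strand u′ i) (strand u′ j)  ≡⟨ link-++ u′ v′ i j ⟨
    link (u′ ++ v′) i j                                ∎

-- The second letter sees the two strands exchanged, but a crossing depends only on the unordered
-- pair, so it is counted for the same pair with the opposite sign.
∼-cancels : (x : Letter (Artin n)) → (x ∷ x ⁻¹ ∷ []) ∼ []
∼-cancels (k , s) = swapAt-involutive k , λ i j → begin
  c i j + (crossing (lo k) (hi k) (Sign.opposite s) (t i) (t j) + 0ℤ)
    ≡⟨ cong (c i j +_) (ℤ.+-identityʳ _) ⟩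
  c i j + crossing (lo k) (hi k) (Sign.opposite s) (t i) (t j)
    ≡⟨ cong (c i j +_) (crossing-opposite (lo k) (hi k) s (t i) (t j)) ⟩
  c i j + - c (t i) (t j)
    ≡⟨ cong (λ z → c i j + - z) (invariant i j) ⟩
  c i j + - c i j
    ≡⟨ ℤ.+-inverseʳ (c i j) ⟩
  0ℤ ∎
  where
  open ≡-Reasoning
  c = crossing (lo k) (hi k) s
  t = swapAt k

  invariant : ∀ i j → c (t i) (t j) ≡ c i j
  invariant i j = begin
    crossing (lo k) (hi k) s (t i) (t j)         ≡⟨ crossing-swap (lo k) (hi k) s (t i) (t j) ⟩
    crossing (hi k) (lo k) s (t i) (t j)         ≡⟨ cong₂ (λ x y → crossing x y s (t i) (t j)) (transpose-ʳ (hi k) (lo k)) (transpose-ˡ (hi k) (lo k)) ⟨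
    crossing (t (lo k)) (t (hi k)) s (t i) (t j) ≡⟨ crossing-equivariant t (swapAt-injective k) (lo k) (hi k) s i j ⟩
    crossing (lo k) (hi k) s i j                 ∎

swapAt-conjugate : (k l : Artin n) (x : Fin n) →
                   swapAt k (swapAt l x) ≡ transpose (swapAt k (hi l)) (swapAt k (lo l)) (swapAt k x)
swapAt-conjugate k l = transpose-conjugate (swapAt k) (swapAt-injective k) (hi l) (lo l)

crossing-swapAt : (k : Artin n) (a b : Fin n) (s : Sign) (i j : Fin n) →
                  crossing a b s (swapAt k i) (swapAt k j) ≡ crossing (swapAt k a) (swapAt k b) s i j
crossing-swapAt k a b s i j =
  trans (sym (crossing-equivariant t (swapAt-injective k) a b s (t i) (t j)))
        (cong₂ (crossing (t a) (t b) s) (swapAt-involutive k i) (swapAt-involutive k j))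
  where t = swapAt k

-- Each exchange fixes both positions of the other, so the same two crossings occur in either order.
∼-far : (k l : Artin n) (s : Sign) → lo k ≢ lo l → lo k ≢ hi l → hi k ≢ lo l → hi k ≢ hi l →
        ((k , s) ∷ (l , s) ∷ []) ∼ ((l , s) ∷ (k , s) ∷ [])
∼-far k l s ll lh hl hh = strands , links
  where
  open ≡-Reasoning

  strands : ∀ i → swapAt l (swapAt k i) ≡ swapAt k (swapAt l i)
  strands i = trans (swapAt-conjugate l k i)
    (cong₂ (λ x y → transpose x y (swapAt l i))
      (transpose-fix (hi l) (lo l) hh hl) (transpose-fix (hi l) (lo l) lh ll))

  fixes : ∀ i j → crossing (lo l) (hi l) s (swapAt k i) (swapAt k j) ≡ crossing (lo l) (hi l) s i j
  fixes i j = trans (crossing-swapAt k (lo l) (hi l) s i j)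
    (cong₂ (λ x y → crossing x y s i j)
      (transpose-fix (hi k) (lo k) (hl ∘ sym) (ll ∘ sym)) (transpose-fix (hi k) (lo k) (hh ∘ sym) (lh ∘ sym)))

  fixes′ : ∀ i j → crossing (lo k) (hi k) s (swapAt l i) (swapAt l j) ≡ crossing (lo k) (hi k) s i j
  fixes′ i j = trans (crossing-swapAt l (lo k) (hi k) s i j)
    (cong₂ (λ x y → crossing x y s i j)
      (transpose-fix (hi l) (lo l) lh ll) (transpose-fix (hi l) (lo l) hh hl))

  links : ∀ i j → link ((k , s) ∷ (l , s) ∷ []) i j ≡ link ((l , s) ∷ (k , s) ∷ []) i j
  links i j = begin
    crossing (lo k) (hi k) s i j + (crossing (lo l) (hi l) s (swapAt k i) (swapAt k j) + 0ℤ)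
      ≡⟨ cong (crossing (lo k) (hi k) s i j +_) (trans (ℤ.+-identityʳ _) (fixes i j)) ⟩
    crossing (lo k) (hi k) s i j + crossing (lo l) (hi l) s i j
      ≡⟨ ℤ.+-comm (crossing (lo k) (hi k) s i j) _ ⟩
    crossing (lo l) (hi l) s i j + crossing (lo k) (hi k) s i j
      ≡⟨ cong (crossing (lo l) (hi l) s i j +_) (trans (ℤ.+-identityʳ _) (fixes′ i j)) ⟨
    crossing (lo l) (hi l) s i j + (crossing (lo k) (hi k) s (swapAt l i) (swapAt l j) + 0ℤ) ∎

-- For the three positions `a`, `b`, `c`, both words cross each of the pairs ab, ac, bc once, in
-- opposite orders, and both permutations are the transposition of `a` and `c`.
∼-near : (k l : Artin n) (s : Sign) → hi k ≡ lo l → lo k ≢ hi l →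
         ((k , s) ∷ (l , s) ∷ (k , s) ∷ []) ∼ ((l , s) ∷ (k , s) ∷ (l , s) ∷ [])
∼-near {n} k l s b≡b′ a≢c = strands , links
  where
  open ≡-Reasoning
  a b c : Fin n
  a = lo k
  b = hi k
  c = hi l

  kb : swapAt k b ≡ a
  kb = transpose-ˡ (hi k) (lo k)

  ka : swapAt k a ≡ b
  ka = transpose-ʳ (hi k) (lo k)

  kc : swapAt k c ≡ c
  kc = transpose-fix (hi k) (lo k) (λ c≡b → lo≢hi l (sym (trans c≡b b≡b′))) (a≢c ∘ sym)

  lc : swapAt l c ≡ b
  lc = trans (transpose-ˡ (hi l) (lo l)) (sym b≡b′)

  lb : swapAt l b ≡ c
  lb = trans (cong (swapAt l) b≡b′) (transpose-ʳ (hi l) (lo l))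

  la : swapAt l a ≡ a
  la = transpose-fix (hi l) (lo l) a≢c (λ a≡b → lo≢hi k (trans a≡b (sym b≡b′)))

  strands : ∀ i → swapAt k (swapAt l (swapAt k i)) ≡ swapAt l (swapAt k (swapAt l i))
  strands i = begin
    swapAt k (swapAt l (swapAt k i))
      ≡⟨ swapAt-conjugate k l (swapAt k i) ⟩
    transpose (swapAt k c) (swapAt k (lo l)) (swapAt k (swapAt k i))
      ≡⟨ cong₂ (λ x y → transpose x y (swapAt k (swapAt k i))) kc (trans (cong (swapAt k) (sym b≡b′)) kb) ⟩
    transpose c a (swapAt k (swapAt k i))
      ≡⟨ cong (transpose c a) (trans (swapAt-involutive k i) (sym (swapAt-involutive l i))) ⟩
    transpose c a (swapAt l (swapAt l i))
      ≡⟨ cong₂ (λ x y → transpose x y (swapAt l (swapAt l i))) lb la ⟨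
    transpose (swapAt l b) (swapAt l a) (swapAt l (swapAt l i))
      ≡⟨ swapAt-conjugate l k (swapAt l i) ⟨
    swapAt l (swapAt k (swapAt l i)) ∎

  X : Fin n → Fin n → Fin n → Fin n → ℤ
  X x y = crossing x y s

  k-moves : ∀ x y {x′ y′} i j → swapAt k x ≡ x′ → swapAt k y ≡ y′ → X x y (swapAt k i) (swapAt k j) ≡ X x′ y′ i j
  k-moves x y i j refl refl = crossing-swapAt k x y s i j

  l-moves : ∀ x y {x′ y′} i j → swapAt l x ≡ x′ → swapAt l y ≡ y′ → X x y (swapAt l i) (swapAt l j) ≡ X x′ y′ i j
  l-moves x y i j refl refl = crossing-swapAt l x y s i j

  lo-l : ∀ i j → X (lo l) c i j ≡ X b c i j
  lo-l i j = cong (λ x → X x c i j) (sym b≡b′)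

  reorder : ∀ x y z → x + (y + (z + 0ℤ)) ≡ z + (y + (x + 0ℤ))
  reorder = solve-∀

  links : ∀ i j → link ((k , s) ∷ (l , s) ∷ (k , s) ∷ []) i j ≡ link ((l , s) ∷ (k , s) ∷ (l , s) ∷ []) i j
  links i j = begin
    X a b i j + (X (lo l) c (swapAt k i) (swapAt k j) + (X a b (swapAt l (swapAt k i)) (swapAt l (swapAt k j)) + 0ℤ))
      ≡⟨ cong₂ (λ y z → X a b i j + (y + (z + 0ℤ)))
           (trans (lo-l (swapAt k i) (swapAt k j)) (k-moves b c i j kb kc))
           (trans (l-moves a b (swapAt k i) (swapAt k j) la lb) (k-moves a c i j ka kc)) ⟩
    X a b i j + (X a c i j + (X b c i j + 0ℤ))
      ≡⟨ reorder (X a b i j) (X a c i j) (X b c i j) ⟩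
    X b c i j + (X a c i j + (X a b i j + 0ℤ))
      ≡⟨ cong₂ (λ y z → X b c i j + (y + (z + 0ℤ)))
           (l-moves a b i j la lb)
           (trans (lo-l (swapAt k (swapAt l i)) (swapAt k (swapAt l j))) (trans (k-moves b c (swapAt l i) (swapAt l j) kb kc) (l-moves a c i j la lc))) ⟨
    X b c i j + (X a b (swapAt l i) (swapAt l j) + (X (lo l) c (swapAt k (swapAt l i)) (swapAt k (swapAt l j)) + 0ℤ))
      ≡⟨ cong (_+ (X a b (swapAt l i) (swapAt l j) + (X (lo l) c (swapAt k (swapAt l i)) (swapAt k (swapAt l j)) + 0ℤ))) (lo-l i j) ⟨
    X (lo l) c i j + (X a b (swapAt l i) (swapAt l j) + (X (lo l) c (swapAt k (swapAt l i)) (swapAt k (swapAt l j)) + 0ℤ)) ∎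

∣-∣≡1 : ∀ m n → ∣ m - n ∣ ≡ 1 → n ≡ suc m ⊎ m ≡ suc n
∣-∣≡1 ℕ.zero    n       eq = inj₁ eq
∣-∣≡1 (suc m) ℕ.zero    eq = inj₂ eq
∣-∣≡1 (suc m) (suc n) eq = Sum.map (cong suc) (cong suc) (∣-∣≡1 m n eq)

∣n-1+n∣≡1 : ∀ n → ∣ n - suc n ∣ ≡ 1
∣n-1+n∣≡1 ℕ.zero    = refl
∣n-1+n∣≡1 (suc n) = ∣n-1+n∣≡1 n

toℕ-lo : (i : Fin n) → toℕ (lo {suc n} (artin i)) ≡ toℕ i
toℕ-lo = Fin.toℕ-inject₁

∼-consecutive : (i j : Fin n) → toℕ j ≡ suc (toℕ i) →
                _∼_ {suc n} (σ i ∷ σ j ∷ σ i ∷ []) (σ j ∷ σ i ∷ σ j ∷ [])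
∼-consecutive i j j≡1+i = ∼-near (artin i) (artin j) Sign.+
  (Fin.toℕ-injective (trans (sym j≡1+i) (sym (toℕ-lo j))))
  (λ eq → ℕ.<⇒≢ (s≤s (ℕ.<⇒≤ (ℕ.≤-reflexive (sym j≡1+i)))) (trans (sym (toℕ-lo i)) (cong toℕ eq)))

∼-relator : {l r : Word (Artin n)} → Relator l r → l ∼ r
∼-relator (cancel x) = ∼-cancels x
∼-relator {suc n} (far i j 2≤∣i-j∣) = ∼-far (artin i) (artin j) Sign.+
  (λ eq → i≢j (trans (sym (toℕ-lo i)) (trans (cong toℕ eq) (toℕ-lo j))))
  (λ eq → i≢1+j (trans (sym (toℕ-lo i)) (cong toℕ eq)))
  (λ eq → j≢1+i (sym (trans (cong toℕ eq) (toℕ-lo j))))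
  (λ eq → i≢j (ℕ.suc-injective (cong toℕ eq)))
  where
  i≢j : toℕ i ≢ toℕ j
  i≢j eq = contradiction (subst (2 ℕ.≤_) (ℕ.m≡n⇒∣m-n∣≡0 eq) 2≤∣i-j∣) λ ()

  j≢1+i : toℕ j ≢ suc (toℕ i)
  j≢1+i eq = contradiction
    (subst (2 ℕ.≤_) (trans (cong (∣ toℕ i -_∣) eq) (∣n-1+n∣≡1 (toℕ i))) 2≤∣i-j∣) λ { (s≤s ()) }

  i≢1+j : toℕ i ≢ suc (toℕ j)
  i≢1+j eq = contradiction
    (subst (2 ℕ.≤_) (trans (ℕ.∣-∣-comm (toℕ i) (toℕ j)) (trans (cong (∣ toℕ j -_∣) eq) (∣n-1+n∣≡1 (toℕ j)))) 2≤∣i-j∣) λ { (s≤s ()) }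
∼-relator {suc n} (near i j ∣i-j∣≡1) with ∣-∣≡1 (toℕ i) (toℕ j) ∣i-j∣≡1
... | inj₁ j≡1+i = ∼-consecutive i j j≡1+i
... | inj₂ i≡1+j = IsEquivalence.sym ∼-isEquivalence (∼-consecutive j i i≡1+j)

≈ᵇ⇒∼ : {u v : Word (Artin n)} → u ≈ᵇ v → u ∼ v
≈ᵇ⇒∼ = extend _∼_ ∼-isEquivalence ∼-++-cong (λ u → u) (λ _ _ → refl) ∼-relator

module Strands {n : ℕ} = Congruence (_∼_ {n}) ∼-isEquivalence ∼-++-cong ∼-cancels

linking≡link : (u : Word (Artin n)) (i j : Fin n) → linking u i j ≡ link u i j
linking≡link = linkingFrom≡link Perm.id

∼⇒≈ᵗ : {u v : Word (Artin n)} → u ∼ v → τ u ≈ᵗ τ v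
∼⇒≈ᵗ {u = u} {v} (p , q) =
  (λ i → trans (sym (Perm.inverseʳ (π v))) (cong (π v ⟨$⟩ʳ_) (trans (sym (p _)) (Perm.inverseˡ (π u))))) ,
  Vec.map-cong (λ (i , j) → trans (linking≡link u i j) (trans (q i j) (sym (linking≡link v i j)))) _

∈-pairs : {i j : Fin n} → i Fin.< j → (i , j) ∈ pairs n
∈-pairs {n} {i} {j} i<j = ∈-concatMap⁺ _ (Any.map (λ { refl → ∈-map⁺ (_, j) (∈-filter⁺ (Fin._<? j) (∈-allFin i) i<j) }) (∈-allFin j))

map-fromList-injective : {A B : Set} {f g : A → B} (xs : List A) →
  Vec.map f (Vec.fromList xs) ≡ Vec.map g (Vec.fromList xs) → ∀ {x} → x ∈ xs → f x ≡ g x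
map-fromList-injective (x ∷ xs) eq (here refl) = Vec.∷-injectiveˡ eq
map-fromList-injective (x ∷ xs) eq (there x∈xs) = map-fromList-injective xs (Vec.∷-injectiveʳ eq) x∈xs

≈ᵗ⇒∼ : {u v : Word (Artin n)} → τ u ≈ᵗ τ v → u ∼ v
≈ᵗ⇒∼ {n} {u} {v} (p , q) = strands , links
  where
  strands : ∀ i → strand u i ≡ strand v i
  strands i = trans (sym (Perm.inverseˡ (π v))) (cong (strand v) (trans (sym (p _)) (Perm.inverseʳ (π u))))

  links< : ∀ i j → i Fin.< j → link u i j ≡ link v i j
  links< i j i<j = trans (sym (linking≡link u i j))
    (trans (map-fromList-injective (pairs n) q (∈-pairs i<j)) (linking≡link v i j))

  links : ∀ i j → link u i j ≡ link v i j
  links i j with Fin.<-cmp i j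
  ... | tri< i<j _ _    = links< i j i<j
  ... | tri≈ _ refl _   = trans (link-diagonal u i) (sym (link-diagonal v i))
  ... | tri> _ _ j<i    = trans (link-sym u i j) (trans (links< j i j<i) (link-sym v j i))

-- Templates under θ and Φ

strand-θ : (u : Word (Artin n)) (i : Fin n) → strand (map _⁻¹ u) i ≡ strand u i
strand-θ []            i = refl
strand-θ ((k , s) ∷ u) i = strand-θ u (swapAt k i)

link-θ : (u : Word (Artin n)) (i j : Fin n) → link (map _⁻¹ u) i j ≡ - link u i j
link-θ []            i j = refl
link-θ ((k , s) ∷ u) i j = trans
  (cong₂ _+_ (crossing-opposite (lo k) (hi k) s i j) (link-θ u _ _))
  (sym (ℤ.neg-distrib-+ (crossing (lo k) (hi k) s i j) _))

∼-θ-cong : {u v : Word (Artin n)} → u ∼ v → map _⁻¹ u ∼ map _⁻¹ v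
∼-θ-cong {u = u} {v} (p , q) =
  (λ i → trans (strand-θ u i) (trans (p i) (sym (strand-θ v i)))) ,
  (λ i j → trans (link-θ u i j) (trans (cong -_ (q i j)) (sym (link-θ v i j))))

opposite-hi : (k : Artin n) → opposite (hi k) ≡ lo (flipArtin k)
opposite-hi {suc n} (artin k) = refl

opposite-lo : (k : Artin n) → opposite (lo k) ≡ hi (flipArtin k)
opposite-lo {suc n} (artin k) =
  -- `inject₁ (opposite (opposite k))` is by definition `opposite (suc (opposite k))`, so inserting
  -- a double `opposite` makes the involution applicable.
  trans (cong (opposite ∘ inject₁) (sym (Fin.opposite-involutive k))) (Fin.opposite-involutive (suc (opposite k)))

opposite-injective : {i j : Fin n} → opposite i ≡ opposite j → i ≡ j
opposite-injective {i = i} {j} eq =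
  trans (sym (Fin.opposite-involutive i)) (trans (cong opposite eq) (Fin.opposite-involutive j))

swapAt-flip : (k : Artin n) (i : Fin n) → swapAt (flipArtin k) (opposite i) ≡ opposite (swapAt k i)
swapAt-flip k i = begin
  transpose (hi (flipArtin k)) (lo (flipArtin k)) (opposite i)
    ≡⟨ cong₂ (λ x y → transpose x y (opposite i)) (opposite-lo k) (opposite-hi k) ⟨
  transpose (opposite (lo k)) (opposite (hi k)) (opposite i)
    ≡⟨ transpose-conjugate opposite opposite-injective (lo k) (hi k) i ⟨
  opposite (transpose (lo k) (hi k) i)
    ≡⟨ cong opposite (transpose-comm (lo k) (hi k) i) ⟩
  opposite (swapAt k i) ∎
  where open ≡-Reasoning

crossing-flip : (k : Artin n) (s : Sign) (i j : Fin n) →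
  crossing (lo (flipArtin k)) (hi (flipArtin k)) s (opposite i) (opposite j) ≡ crossing (lo k) (hi k) s i j
crossing-flip k s i j = begin
  crossing (lo (flipArtin k)) (hi (flipArtin k)) s (opposite i) (opposite j)
    ≡⟨ cong₂ (λ x y → crossing x y s (opposite i) (opposite j)) (opposite-hi k) (opposite-lo k) ⟨
  crossing (opposite (hi k)) (opposite (lo k)) s (opposite i) (opposite j)
    ≡⟨ crossing-equivariant opposite opposite-injective (hi k) (lo k) s i j ⟩
  crossing (hi k) (lo k) s i j
    ≡⟨ crossing-swap (hi k) (lo k) s i j ⟩
  crossing (lo k) (hi k) s i j ∎
  where open ≡-Reasoning

Φ : Word (Artin n) → Word (Artin n)
Φ = letterwise flipArtin

strand-Φ : (u : Word (Artin n)) (i : Fin n) → strand (Φ u) (opposite i) ≡ opposite (strand u i)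
strand-Φ []            i = refl
strand-Φ ((k , s) ∷ u) i = trans (cong (strand (Φ u)) (swapAt-flip k i)) (strand-Φ u (swapAt k i))

link-Φ : (u : Word (Artin n)) (i j : Fin n) → link (Φ u) (opposite i) (opposite j) ≡ link u i j
link-Φ []            i j = refl
link-Φ ((k , s) ∷ u) i j = cong₂ _+_ (crossing-flip k s i j)
  (trans (cong₂ (link (Φ u)) (swapAt-flip k i) (swapAt-flip k j)) (link-Φ u _ _))

-- The flip reverses the numbering of positions, which gives the identities at arguments of the form
-- `opposite i`; every position has this form.
∼-Φ-cong : {u v : Word (Artin n)} → u ∼ v → Φ u ∼ Φ v
∼-Φ-cong {n} {u} {v} (p , q) =
  (λ i → subst (λ x → strand (Φ u) x ≡ strand (Φ v) x) (Fin.opposite-involutive i) (strands (opposite i))) ,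
  (λ i j → subst₂ (λ x y → link (Φ u) x y ≡ link (Φ v) x y)
             (Fin.opposite-involutive i) (Fin.opposite-involutive j) (links (opposite i) (opposite j)))
  where
  strands : ∀ i → strand (Φ u) (opposite i) ≡ strand (Φ v) (opposite i)
  strands i = trans (strand-Φ u i) (trans (cong opposite (p i)) (sym (strand-Φ v i)))

  links : ∀ i j → link (Φ u) (opposite i) (opposite j) ≡ link (Φ v) (opposite i) (opposite j)
  links i j = trans (link-Φ u i j) (trans (q i j) (sym (link-Φ v i j)))

-- Conjugation by δ rotates the band generators

module Conjugation {c ℓ} (G : Group c ℓ) where
  open Group G renaming (_∙_ to _·_; _⁻¹ to _⁻; refl to ≈-refl; sym to ≈-sym; trans to ≈-trans)
  open GroupProperties G
  open SetoidReasoning setoid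

  infixr 6 _▷_
  -- Bracketed to the right so that, on words, `c ▷ [ σ q ]` has literally the shape of `bandWord`.
  _▷_ : Carrier → Carrier → Carrier
  x ▷ y = x · (y · x ⁻)

  ▷-cong : ∀ {x x′ y y′} → x ≈ x′ → y ≈ y′ → x ▷ y ≈ x′ ▷ y′
  ▷-cong p q = ∙-cong p (∙-cong q (⁻¹-cong p))

  ▷-congˡ : ∀ x {y y′} → y ≈ y′ → x ▷ y ≈ x ▷ y′
  ▷-congˡ x q = ∙-cong ≈-refl (∙-cong q ≈-refl)

  -- With its converse `▷-elim`, this turns claims about conjugates into equations without inverses,
  -- to which the braid relations apply directly.
  ▷-intro : ∀ {x y z} → x · y ≈ z · x → x ▷ y ≈ z
  ▷-intro {x} {y} {z} xy≈zx = begin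
    x · (y · x ⁻)  ≈⟨ assoc x y (x ⁻) ⟨
    (x · y) · x ⁻  ≈⟨ ∙-congʳ xy≈zx ⟩
    (z · x) · x ⁻  ≈⟨ //-rightDividesʳ x z ⟩
    z               ∎

  ▷-elim : ∀ {x y z} → x ▷ y ≈ z → x · y ≈ z · x
  ▷-elim {x} {y} {z} x▷y≈z = begin
    x · y                  ≈⟨ //-rightDividesˡ x (x · y) ⟨
    ((x · y) · x ⁻) · x   ≈⟨ ∙-congʳ (assoc x y (x ⁻)) ⟩
    (x ▷ y) · x            ≈⟨ ∙-congʳ x▷y≈z ⟩
    z · x                  ∎

  ▷-identityˡ : ∀ x → ε ▷ x ≈ x
  ▷-identityˡ x = ▷-intro (≈-trans (identityˡ x) (≈-sym (identityʳ x)))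

  ▷-ε : ∀ x → x ▷ ε ≈ ε
  ▷-ε x = ▷-intro (≈-trans (identityʳ x) (≈-sym (identityˡ x)))

  ▷-self : ∀ x → x ▷ x ≈ x
  ▷-self x = ▷-intro ≈-refl

  ▷-∙ : ∀ x y z → x ▷ (y · z) ≈ (x ▷ y) · (x ▷ z)
  ▷-∙ x y z = ▷-intro (begin
    x · (y · z)               ≈⟨ assoc x y z ⟨
    (x · y) · z               ≈⟨ ∙-congʳ (▷-elim ≈-refl) ⟩
    ((x ▷ y) · x) · z         ≈⟨ assoc (x ▷ y) x z ⟩
    (x ▷ y) · (x · z)         ≈⟨ ∙-congˡ (▷-elim ≈-refl) ⟩
    (x ▷ y) · ((x ▷ z) · x)   ≈⟨ assoc (x ▷ y) (x ▷ z) x ⟨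
    ((x ▷ y) · (x ▷ z)) · x   ∎)

  ▷-⁻¹ : ∀ x y → x ▷ (y ⁻) ≈ (x ▷ y) ⁻
  ▷-⁻¹ x y = inverseʳ-unique (x ▷ y) (x ▷ (y ⁻)) (begin
    (x ▷ y) · (x ▷ (y ⁻))  ≈⟨ ▷-∙ x y (y ⁻) ⟨
    x ▷ (y · y ⁻)          ≈⟨ ▷-congˡ x (inverseʳ y) ⟩
    x ▷ ε                   ≈⟨ ▷-ε x ⟩
    ε                       ∎)

  ▷-action : ∀ x y z → (x · y) ▷ z ≈ x ▷ y ▷ z
  ▷-action x y z = ▷-intro (begin
    (x · y) · z                ≈⟨ assoc x y z ⟩
    x · (y · z)                ≈⟨ ∙-congˡ (▷-elim ≈-refl) ⟩
    x · ((y ▷ z) · y)          ≈⟨ assoc x (y ▷ z) y ⟨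
    (x · (y ▷ z)) · y          ≈⟨ ∙-congʳ (▷-elim ≈-refl) ⟩
    ((x ▷ y ▷ z) · x) · y      ≈⟨ assoc (x ▷ y ▷ z) x y ⟩
    (x ▷ y ▷ z) · (x · y)      ∎)

  -- Self-distributivity: conjugation by `x` is an automorphism. It lets δ act separately on the two
  -- parts `seg` and `s` of a band.
  ▷-▷ : ∀ x y z → x ▷ y ▷ z ≈ (x ▷ y) ▷ x ▷ z
  ▷-▷ x y z = begin
    x ▷ (y · (z · y ⁻))                         ≈⟨ ▷-∙ x y (z · y ⁻) ⟩
    (x ▷ y) · (x ▷ (z · y ⁻))                   ≈⟨ ∙-congˡ (▷-∙ x z (y ⁻)) ⟩
    (x ▷ y) · ((x ▷ z) · (x ▷ (y ⁻)))           ≈⟨ ∙-congˡ (∙-congˡ (▷-⁻¹ x y)) ⟩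
    (x ▷ y) ▷ x ▷ z                              ∎

  ▷-commute : ∀ {x y} → x ▷ y ≈ y → y ▷ x ≈ x
  ▷-commute x▷y≈y = ▷-intro (≈-sym (▷-elim x▷y≈y))

  -- The braid relation read as a conjugation: the product of two neighbouring generators carries
  -- the first to the second.
  braid⇒▷ : ∀ {x y} → x · (y · x) ≈ y · (x · y) → x ▷ y ▷ x ≈ y
  braid⇒▷ {x} {y} xyx≈yxy = begin
    x ▷ y ▷ x    ≈⟨ ▷-action x y x ⟨
    (x · y) ▷ x  ≈⟨ ▷-intro (≈-trans (assoc x y x) xyx≈yxy) ⟩
    y            ∎

-- Lists of consecutive indices

filter-map : {A B : Set} {P : Pred B 0ℓ} (P? : Decidable P) (f : A → B) (xs : List A) →
             filter P? (map f xs) ≡ map f (filter (P? ∘ f) xs)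
filter-map P? f []       = refl
filter-map P? f (x ∷ xs) with ih ← filter-map P? f xs | does (P? (f x))
... | true  = cong (f x ∷_) ih
... | false = ih

InRange : ℕ → ℕ → Pred (Fin m) 0ℓ
InRange p q k = p ≤ toℕ k × toℕ k < q

inRange? : (p q : ℕ) → Decidable (InRange {m} p q)
inRange? p q k = (p ℕ.≤? toℕ k) ×-dec (toℕ k ℕ.<? q)

-- The same filter as in `bandWord`, so that `bandWord≡a` holds almost by definition.
range : ∀ m → ℕ → ℕ → List (Fin m)
range m p q = filter (inRange? p q) (allFin m)

range-empty : ∀ m {p q} → q ≤ p → range m p q ≡ []
range-empty m {p} {q} q≤p = List.filter-none (inRange? p q)
  (All.universal (λ _ (p≤k , k<q) → ℕ.<⇒≱ (ℕ.≤-<-trans p≤k k<q) q≤p) (allFin m))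

range-full : ∀ m → range m 0 m ≡ allFin m
range-full m = List.filter-all (inRange? 0 m)
  (All.universal (λ k → z≤n , Fin.toℕ<n k) (allFin m))

tabulate-suc : ∀ m → tabulate Fin.suc ≡ map Fin.suc (allFin m)
tabulate-suc m = sym (List.map-tabulate id suc)

range-0-suc : ∀ m q → range (suc m) 0 (suc q) ≡ zero ∷ map suc (range m 0 q)
range-0-suc m q = cong (zero ∷_) (begin
  filter (inRange? 0 (suc q)) (tabulate suc)          ≡⟨ cong (filter (inRange? _ _)) (tabulate-suc m) ⟩
  filter (inRange? 0 (suc q)) (map suc (allFin m))    ≡⟨ filter-map _ suc (allFin m) ⟩
  map suc (filter (inRange? 0 (suc q) ∘ suc) (allFin m))
    ≡⟨ cong (map suc) (List.filter-≐ _ _ ((λ { (_ , s≤s k<q) → z≤n , k<q }) , λ (_ , k<q) → z≤n , s≤s k<q) (allFin m)) ⟩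
  map suc (range m 0 q) ∎)
  where open ≡-Reasoning

range-suc-suc : ∀ m p q → range (suc m) (suc p) (suc q) ≡ map suc (range m p q)
range-suc-suc m p q = begin
  filter (inRange? (suc p) (suc q)) (tabulate suc)          ≡⟨ cong (filter (inRange? _ _)) (tabulate-suc m) ⟩
  filter (inRange? (suc p) (suc q)) (map suc (allFin m))    ≡⟨ filter-map _ suc (allFin m) ⟩
  map suc (filter (inRange? (suc p) (suc q) ∘ suc) (allFin m))
    ≡⟨ cong (map suc) (List.filter-≐ _ _ ((λ { (s≤s p≤k , s≤s k<q) → p≤k , k<q }) , λ (p≤k , k<q) → s≤s p≤k , s≤s k<q) (allFin m)) ⟩
  map suc (range m p q) ∎
  where open ≡-Reasoning

range-snoc : ∀ m {p} (q : Fin m) → p ≤ toℕ q → range m p (suc (toℕ q)) ≡ range m p (toℕ q) ++ [ q ]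
range-snoc (suc m) {ℕ.zero} zero p≤q = begin
  range (suc m) 0 1              ≡⟨ range-0-suc m 0 ⟩
  zero ∷ map suc (range m 0 0)   ≡⟨ cong (λ ks → zero ∷ map suc ks) (range-empty m {0} {0} z≤n) ⟩
  [ zero ]                       ≡⟨ cong (_++ [ zero ]) (range-empty (suc m) {0} {0} z≤n) ⟨
  range (suc m) 0 0 ++ [ zero ]  ∎
  where open ≡-Reasoning
range-snoc (suc m) {ℕ.zero} (suc q) p≤q = begin
  range (suc m) 0 (suc (suc (toℕ q)))           ≡⟨ range-0-suc m (suc (toℕ q)) ⟩
  zero ∷ map suc (range m 0 (suc (toℕ q)))      ≡⟨ cong (λ ks → zero ∷ map suc ks) (range-snoc m q z≤n) ⟩
  zero ∷ map suc (range m 0 (toℕ q) ++ [ q ])   ≡⟨ cong (zero ∷_) (List.map-++ suc (range m 0 (toℕ q)) [ q ]) ⟩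
  zero ∷ map suc (range m 0 (toℕ q)) ++ [ suc q ] ≡⟨ cong (_++ [ suc q ]) (range-0-suc m (toℕ q)) ⟨
  range (suc m) 0 (suc (toℕ q)) ++ [ suc q ]    ∎
  where open ≡-Reasoning
range-snoc (suc m) {suc p} (suc q) (s≤s p≤q) = begin
  range (suc m) (suc p) (suc (suc (toℕ q)))           ≡⟨ range-suc-suc m p (suc (toℕ q)) ⟩
  map suc (range m p (suc (toℕ q)))                   ≡⟨ cong (map suc) (range-snoc m q p≤q) ⟩
  map suc (range m p (toℕ q) ++ [ q ])                ≡⟨ List.map-++ suc (range m p (toℕ q)) [ q ] ⟩
  map suc (range m p (toℕ q)) ++ [ suc q ]            ≡⟨ cong (_++ [ suc q ]) (range-suc-suc m p (toℕ q)) ⟨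
  range (suc m) (suc p) (suc (toℕ q)) ++ [ suc q ]    ∎
  where open ≡-Reasoning

δ : Word (Artin n)
δ {n} = map σ (allFin (pred n))

module Rotation (m : ℕ) where
  open Conjugation (Braid.group {suc m})
  open SetoidReasoning (braidSetoid (suc m))

  -- σ_{p+1} ⋯ σ_q in the numbering of the paper.
  seg : ℕ → ℕ → Word (Artin (suc m))
  seg p q = map σ (range m p q)

  -- σ_{k+1} in the numbering of the paper; empty unless k < m.
  s : ℕ → Word (Artin (suc m))
  s k = seg k (suc k)

  seg-empty : ∀ {p q} → q ≤ p → seg p q ≡ []
  seg-empty q≤p = cong (map σ) (range-empty m q≤p)

  seg-snoc′ : ∀ {p} (q : Fin m) → p ≤ toℕ q → seg p (suc (toℕ q)) ≡ seg p (toℕ q) ++ [ σ q ]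
  seg-snoc′ {p} q p≤q = trans (cong (map σ) (range-snoc m q p≤q)) (List.map-++ σ (range m p (toℕ q)) [ q ])

  s-toℕ : (k : Fin m) → s (toℕ k) ≡ [ σ k ]
  s-toℕ k = trans (seg-snoc′ k ℕ.≤-refl) (cong (_++ [ σ k ]) (seg-empty {toℕ k} ℕ.≤-refl))

  δ≡seg : δ ≡ seg 0 m
  δ≡seg = cong (map σ) (sym (range-full m))

  -- Indices are computed in ℕ, while relators speak of `Fin m`. Matching on `Index k` replaces a
  -- number below `m` by `toℕ` of a generator index.
  data Index : ℕ → Set where
    index : (k : Fin m) → Index (toℕ k)

  toIndex : ∀ {k} → k < m → Index k
  toIndex k<m = subst Index (Fin.toℕ-fromℕ< k<m) (index (fromℕ< k<m))

  seg-snoc : ∀ {p q} → p ≤ q → q < m → seg p (suc q) ≡ seg p q ++ s q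
  seg-snoc {p} p≤q q<m with toIndex q<m
  ... | index q = trans (seg-snoc′ q p≤q) (cong (seg p (toℕ q) ++_) (sym (s-toℕ q)))

  s-far : ∀ {i j} → suc i < j → j < m → s i ++ s j ≈ᵇ s j ++ s i
  s-far {i} {j} 1+i<j j<m with toIndex (ℕ.<-trans (ℕ.<-trans (ℕ.n<1+n i) 1+i<j) j<m) | toIndex j<m
  ... | index i | index j rewrite s-toℕ i | s-toℕ j = relator (far i j
    (subst (2 ≤_) (sym (ℕ.m≤n⇒∣m-n∣≡n∸m (ℕ.≤-trans (ℕ.n≤1+n _) (ℕ.<⇒≤ 1+i<j))))
      (ℕ.m+n≤o⇒m≤o∸n 2 1+i<j)))

  s-near : ∀ {i} → suc i < m → s i ++ s (suc i) ++ s i ≈ᵇ s (suc i) ++ s i ++ s (suc i)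
  s-near {i} 1+i<m = consecutive (toIndex (ℕ.<-trans (ℕ.n<1+n i) 1+i<m)) (toIndex 1+i<m) refl
    where
    -- `j` is kept apart from `suc i`: matching on `Index (suc i)` directly would have to unify
    -- `toℕ` of an index with a successor.
    consecutive : ∀ {i j} → Index i → Index j → j ≡ suc i → s i ++ s j ++ s i ≈ᵇ s j ++ s i ++ s j
    consecutive (index i) (index j) j≡1+i rewrite s-toℕ i | s-toℕ j =
      relator (near i j (trans (cong (∣ toℕ i -_∣) j≡1+i) (∣n-1+n∣≡1 (toℕ i))))

  s▷s-below : ∀ {i j} → suc i < j → j < m → s i ▷ s j ≈ᵇ s j
  s▷s-below 1+i<j j<m = ▷-intro (s-far 1+i<j j<m)

  s▷s-above : ∀ {i j} → suc i < j → j < m → s j ▷ s i ≈ᵇ s i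
  s▷s-above 1+i<j j<m = ▷-commute (s▷s-below 1+i<j j<m)

  -- All letters of `seg 0 j` have index below `j`, hence distance at least two from `k`.
  seg▷s-fixed : ∀ j {k} → j < k → k < m → seg 0 j ▷ s k ≈ᵇ s k
  seg▷s-fixed ℕ.zero {k} j<k k<m = begin
    seg 0 0 ▷ s k  ≡⟨ cong (_▷ s k) (seg-empty {0} z≤n) ⟩
    [] ▷ s k       ≈⟨ ▷-identityˡ (s k) ⟩
    s k            ∎
  seg▷s-fixed (suc j) {k} 1+j<k k<m = begin
    seg 0 (suc j) ▷ s k      ≡⟨ cong (_▷ s k) (seg-snoc z≤n (ℕ.<-trans j<k k<m)) ⟩
    (seg 0 j ++ s j) ▷ s k   ≈⟨ ▷-action (seg 0 j) (s j) (s k) ⟩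
    seg 0 j ▷ s j ▷ s k      ≈⟨ ▷-congˡ (seg 0 j) (s▷s-below 1+j<k k<m) ⟩
    seg 0 j ▷ s k            ≈⟨ seg▷s-fixed j j<k k<m ⟩
    s k                      ∎
    where j<k = ℕ.<-trans (ℕ.n<1+n j) 1+j<k

  -- The rightmost letters act first. The `d` letters beyond index `suc k` commute with `s k`; then
  -- `s k ++ s (suc k)` carries `s k` to `s (suc k)` by the braid relation; the letters before index
  -- `k` leave that fixed.
  seg▷s-shift : ∀ d {k} → d ℕ.+ suc (suc k) ≤ m → seg 0 (d ℕ.+ suc (suc k)) ▷ s k ≈ᵇ s (suc k)
  seg▷s-shift ℕ.zero {k} 2+k≤m = begin
    seg 0 (suc (suc k)) ▷ s k                    ≡⟨ cong (_▷ s k) (seg-snoc z≤n 2+k≤m) ⟩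
    (seg 0 (suc k) ++ s (suc k)) ▷ s k           ≡⟨ cong (λ w → (w ++ s (suc k)) ▷ s k) (seg-snoc z≤n (ℕ.<⇒≤ 2+k≤m)) ⟩
    ((seg 0 k ++ s k) ++ s (suc k)) ▷ s k        ≈⟨ ▷-action (seg 0 k ++ s k) (s (suc k)) (s k) ⟩
    (seg 0 k ++ s k) ▷ s (suc k) ▷ s k           ≈⟨ ▷-action (seg 0 k) (s k) (s (suc k) ▷ s k) ⟩
    seg 0 k ▷ s k ▷ s (suc k) ▷ s k              ≈⟨ ▷-congˡ (seg 0 k) (braid⇒▷ (s-near 2+k≤m)) ⟩
    seg 0 k ▷ s (suc k)                          ≈⟨ seg▷s-fixed k (ℕ.n<1+n k) 2+k≤m ⟩
    s (suc k)                                    ∎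
  seg▷s-shift (suc d) {k} d+2+k<m = begin
    seg 0 (suc j) ▷ s k      ≡⟨ cong (_▷ s k) (seg-snoc z≤n d+2+k<m) ⟩
    (seg 0 j ++ s j) ▷ s k   ≈⟨ ▷-action (seg 0 j) (s j) (s k) ⟩
    seg 0 j ▷ s j ▷ s k      ≈⟨ ▷-congˡ (seg 0 j) (s▷s-above (ℕ.m≤n+m (suc (suc k)) d) d+2+k<m) ⟩
    seg 0 j ▷ s k            ≈⟨ seg▷s-shift d (ℕ.<⇒≤ d+2+k<m) ⟩
    s (suc k)                ∎
    where j = d ℕ.+ suc (suc k)

  δ▷s : ∀ {k} → suc k < m → δ ▷ s k ≈ᵇ s (suc k)
  δ▷s {k} 1+k<m = begin
    δ ▷ s k                                      ≡⟨ cong (_▷ s k) δ≡seg ⟩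
    seg 0 m ▷ s k                                ≡⟨ cong (λ j → seg 0 j ▷ s k) eq ⟨
    seg 0 (m ℕ.∸ suc (suc k) ℕ.+ suc (suc k)) ▷ s k ≈⟨ seg▷s-shift (m ℕ.∸ suc (suc k)) (ℕ.≤-reflexive eq) ⟩
    s (suc k)                                    ∎
    where eq = ℕ.m∸n+n≡m 1+k<m

  δ▷seg : ∀ p q → q < m → δ ▷ seg p q ≈ᵇ seg (suc p) (suc q)
  δ▷seg p q q<m with q ℕ.≤? p
  ... | yes q≤p = begin
    δ ▷ seg p q          ≡⟨ cong (δ ▷_) (seg-empty q≤p) ⟩
    δ ▷ []               ≈⟨ ▷-ε δ ⟩
    []                   ≡⟨ seg-empty (s≤s q≤p) ⟨
    seg (suc p) (suc q)  ∎
  δ▷seg p ℕ.zero    q<m | no q≰p = contradiction z≤n q≰p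
  δ▷seg p (suc q) 1+q<m | no q≰p = begin
    δ ▷ seg p (suc q)                  ≡⟨ cong (δ ▷_) (seg-snoc p≤q (ℕ.<⇒≤ 1+q<m)) ⟩
    δ ▷ (seg p q ++ s q)               ≈⟨ ▷-∙ δ (seg p q) (s q) ⟩
    (δ ▷ seg p q) ++ (δ ▷ s q)         ≈⟨ ++-cong (δ▷seg p q (ℕ.<⇒≤ 1+q<m)) (δ▷s 1+q<m) ⟩
    seg (suc p) (suc q) ++ s (suc q)   ≡⟨ seg-snoc (s≤s p≤q) 1+q<m ⟨
    seg (suc p) (suc (suc q))          ∎
    where p≤q = ℕ.≤-pred (ℕ.≰⇒> q≰p)

  -- a_{p+1,q+2} in the numbering of the paper.
  a : ℕ → ℕ → Word (Artin (suc m))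
  a p q = seg p q ▷ s q

  δ▷a : ∀ {p q} → suc q < m → δ ▷ a p q ≈ᵇ a (suc p) (suc q)
  δ▷a {p} {q} 1+q<m = begin
    δ ▷ seg p q ▷ s q                ≈⟨ ▷-▷ δ (seg p q) (s q) ⟩
    (δ ▷ seg p q) ▷ δ ▷ s q          ≈⟨ ▷-cong (δ▷seg p q (ℕ.<⇒≤ 1+q<m)) (δ▷s 1+q<m) ⟩
    seg (suc p) (suc q) ▷ s (suc q)  ∎

  -- `s (suc j)` commutes with `seg 0 j`, and the braid relation on the remaining two generators
  -- shortens the band by one strand.
  s▷a : ∀ {j} → suc j < m → s (suc j) ▷ a 0 (suc j) ≈ᵇ a 0 j
  s▷a {j} 1+j<m = begin
    s (suc j) ▷ seg 0 (suc j) ▷ s (suc j)               ≡⟨ cong (λ w → s (suc j) ▷ w ▷ s (suc j)) (seg-snoc z≤n (ℕ.<⇒≤ 1+j<m)) ⟩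
    s (suc j) ▷ (seg 0 j ++ s j) ▷ s (suc j)            ≈⟨ ▷-congˡ (s (suc j)) (▷-action (seg 0 j) (s j) (s (suc j))) ⟩
    s (suc j) ▷ seg 0 j ▷ s j ▷ s (suc j)               ≈⟨ ▷-▷ (s (suc j)) (seg 0 j) (s j ▷ s (suc j)) ⟩
    (s (suc j) ▷ seg 0 j) ▷ s (suc j) ▷ s j ▷ s (suc j) ≈⟨ ▷-cong (▷-commute (seg▷s-fixed j (ℕ.n<1+n j) 1+j<m)) (braid⇒▷ (≈ᵇ.sym (s-near 1+j<m))) ⟩
    seg 0 j ▷ s j                                       ∎

  -- The letters of the segment, acting from the right, move the far end of the band down one strand
  -- at a time; `d` counts these moves.
  seg▷a : ∀ d p → p ℕ.+ d < m → seg (suc p) (suc (p ℕ.+ d)) ▷ a 0 (p ℕ.+ d) ≈ᵇ a 0 p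
  seg▷a ℕ.zero p p+0<m rewrite ℕ.+-identityʳ p = begin
    seg (suc p) (suc p) ▷ a 0 p  ≡⟨ cong (_▷ a 0 p) (seg-empty {suc p} ℕ.≤-refl) ⟩
    [] ▷ a 0 p                   ≈⟨ ▷-identityˡ (a 0 p) ⟩
    a 0 p                        ∎
  seg▷a (suc d) p p+1+d<m rewrite ℕ.+-suc p d = begin
    seg (suc p) (suc (suc (p ℕ.+ d))) ▷ a 0 (suc (p ℕ.+ d))
      ≡⟨ cong (_▷ a 0 (suc (p ℕ.+ d))) (seg-snoc (s≤s (ℕ.m≤m+n p d)) p+1+d<m) ⟩
    (seg (suc p) (suc (p ℕ.+ d)) ++ s (suc (p ℕ.+ d))) ▷ a 0 (suc (p ℕ.+ d))
      ≈⟨ ▷-action (seg (suc p) (suc (p ℕ.+ d))) (s (suc (p ℕ.+ d))) (a 0 (suc (p ℕ.+ d))) ⟩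
    seg (suc p) (suc (p ℕ.+ d)) ▷ s (suc (p ℕ.+ d)) ▷ a 0 (suc (p ℕ.+ d))
      ≈⟨ ▷-congˡ (seg (suc p) (suc (p ℕ.+ d))) (s▷a p+1+d<m) ⟩
    seg (suc p) (suc (p ℕ.+ d)) ▷ a 0 (p ℕ.+ d)
      ≈⟨ seg▷a d p (ℕ.<⇒≤ p+1+d<m) ⟩
    a 0 p ∎

  -- The wrap-around case. δ ends in `s q`, which fixes itself, so `s q` becomes the longest band
  -- `a 0 q`; the segment, shifted by one, then brings its far end back down to `a 0 p`.
  δ▷a-last : ∀ {p q} → p ≤ q → suc q ≡ m → δ ▷ a p q ≈ᵇ a 0 p
  δ▷a-last {p} {q} p≤q 1+q≡m = begin
    δ ▷ seg p q ▷ s q                                  ≈⟨ ▷-▷ δ (seg p q) (s q) ⟩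
    (δ ▷ seg p q) ▷ δ ▷ s q                            ≈⟨ ▷-cong (δ▷seg p q q<m) last ⟩
    seg (suc p) (suc q) ▷ a 0 q                        ≡⟨ cong (λ q → seg (suc p) (suc q) ▷ a 0 q) p+d≡q ⟨
    seg (suc p) (suc (p ℕ.+ d)) ▷ a 0 (p ℕ.+ d)            ≈⟨ seg▷a d p (subst (_< m) (sym p+d≡q) q<m) ⟩
    a 0 p                                              ∎
    where
    q<m = ℕ.≤-reflexive 1+q≡m
    d   = q ℕ.∸ p

    p+d≡q : p ℕ.+ d ≡ q
    p+d≡q = ℕ.m+[n∸m]≡n p≤q

    last : δ ▷ s q ≈ᵇ a 0 q
    last = begin
      δ ▷ s q                 ≡⟨ cong (_▷ s q) (trans δ≡seg (trans (cong (seg 0) (sym 1+q≡m)) (seg-snoc z≤n q<m))) ⟩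
      (seg 0 q ++ s q) ▷ s q  ≈⟨ ▷-action (seg 0 q) (s q) (s q) ⟩
      seg 0 q ▷ s q ▷ s q     ≈⟨ ▷-congˡ (seg 0 q) (▷-self (s q)) ⟩
      seg 0 q ▷ s q           ∎

  bandWord≡a : (p q : Fin (suc m)) (p<q : p Fin.< q) → bandWord a⟨ p , q , p<q ⟩ ≡ a (toℕ p) (pred (toℕ q))
  bandWord≡a p (suc q) p<q = cong (seg (toℕ p) (toℕ q) ▷_) (sym (s-toℕ q))

  bandWord-band< : (p q : Fin (suc m)) (p≢q : p ≢ q) → toℕ p < toℕ q →
                   bandWord (band p q p≢q) ≡ a (toℕ p) (pred (toℕ q))
  bandWord-band< p q p≢q p<q with Fin.<-cmp p q
  ... | tri< p<q′ _ _ = bandWord≡a p q p<q′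
  ... | tri≈ _ p≡q _  = contradiction p≡q p≢q
  ... | tri> ¬p<q _ _ = contradiction p<q ¬p<q

  bandWord-band> : (p q : Fin (suc m)) (p≢q : p ≢ q) → toℕ q < toℕ p →
                   bandWord (band p q p≢q) ≡ a (toℕ q) (pred (toℕ p))
  bandWord-band> p q p≢q q<p with Fin.<-cmp p q
  ... | tri< _ _ ¬q<p = contradiction q<p ¬q<p
  ... | tri≈ _ p≡q _  = contradiction p≡q p≢q
  ... | tri> _ _ q<p′ = bandWord≡a q p q<p′

  rotate-inject₁ : (k : Fin m) → rotate (inject₁ k) ≡ suc k
  rotate-inject₁ k rewrite view-inject₁ k = refl

  rotate-fromℕ : rotate (fromℕ m) ≡ zero
  rotate-fromℕ rewrite view-fromℕ m = refl

  rotate-surjective : (k : Fin (suc m)) → ∃[ k′ ] rotate k′ ≡ k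
  rotate-surjective zero    = fromℕ m , rotate-fromℕ
  rotate-surjective (suc k) = inject₁ k , rotate-inject₁ k

  toℕ-rotate : (k : Fin (suc m)) → toℕ k < m → toℕ (rotate k) ≡ suc (toℕ k)
  toℕ-rotate k k<m with view k
  ... | ‵fromℕ     = contradiction (subst (_< m) (Fin.toℕ-fromℕ m) k<m) (ℕ.<-irrefl refl)
  ... | ‵inject₁ i = cong suc (sym (Fin.toℕ-inject₁ i))

  toℕ-rotate-last : (k : Fin (suc m)) → toℕ k ≡ m → toℕ (rotate k) ≡ 0
  toℕ-rotate-last k k≡m with view k
  ... | ‵fromℕ     = refl
  ... | ‵inject₁ i = contradiction (trans (sym (Fin.toℕ-inject₁ i)) k≡m) (ℕ.<⇒≢ (Fin.toℕ<n i))

  bandWord-rotateBand : (x : Band (suc m)) → bandWord (rotateBand x) ≈ᵇ δ ▷ bandWord x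
  bandWord-rotateBand a⟨ p , suc q , p<q@(s≤s p≤q) ⟩ with suc (toℕ q) ℕ.<? m
  ... | yes 1+q<m = begin
    bandWord (band (rotate p) (rotate (suc q)) _)
      ≡⟨ bandWord-band< (rotate p) (rotate (suc q)) _ (subst₂ _<_ (sym rp) (sym rq) (s≤s p<q)) ⟩
    a (toℕ (rotate p)) (pred (toℕ (rotate (suc q))))
      ≡⟨ cong₂ (λ x y → a x (pred y)) rp rq ⟩
    a (suc (toℕ p)) (suc (toℕ q))
      ≈⟨ δ▷a 1+q<m ⟨
    δ ▷ a (toℕ p) (toℕ q)
      ≡⟨ cong (δ ▷_) (bandWord≡a p (suc q) p<q) ⟨
    δ ▷ bandWord a⟨ p , suc q , p<q ⟩ ∎
    where
    rp = toℕ-rotate p (ℕ.≤-<-trans p≤q (ℕ.<⇒≤ 1+q<m))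
    rq = toℕ-rotate (suc q) 1+q<m
  -- Here the upper end is the last position and rotates to zero, so the two ends change their
  -- order.
  ... | no 1+q≮m = begin
    bandWord (band (rotate p) (rotate (suc q)) _)
      ≡⟨ bandWord-band> (rotate p) (rotate (suc q)) _ (subst₂ _<_ (sym rq) (sym rp) (s≤s z≤n)) ⟩
    a (toℕ (rotate (suc q))) (pred (toℕ (rotate p)))
      ≡⟨ cong₂ (λ x y → a x (pred y)) rq rp ⟩
    a 0 (toℕ p)
      ≈⟨ δ▷a-last p≤q 1+q≡m ⟨
    δ ▷ a (toℕ p) (toℕ q)
      ≡⟨ cong (δ ▷_) (bandWord≡a p (suc q) p<q) ⟨
    δ ▷ bandWord a⟨ p , suc q , p<q ⟩ ∎
    where
    1+q≡m = ℕ.≤-antisym (Fin.toℕ<n q) (ℕ.≮⇒≥ 1+q≮m)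
    rp = toℕ-rotate p (ℕ.≤-<-trans p≤q (Fin.toℕ<n q))
    rq = toℕ-rotate-last (suc q) 1+q≡m

  -- The preimages of two ordered ends may come in the opposite order, hence the unordered `band`.
  -- Comparing words keeps the order proofs inside a `Band` out of sight.
  rotateBand-surjective : (x : Band (suc m)) → ∃[ y ] bandWord (rotateBand y) ≡ bandWord x
  rotateBand-surjective a⟨ p , q , p<q ⟩ with rotate-surjective p | rotate-surjective q
  ... | p′ , refl | q′ , refl = band p′ q′ p′≢q′ , rotated
    where
    p′≢q′ : p′ ≢ q′
    p′≢q′ refl = ℕ.<-irrefl refl p<q

    rotated : bandWord (rotateBand (band p′ q′ p′≢q′)) ≡ bandWord a⟨ rotate p′ , rotate q′ , p<q ⟩
    rotated with Fin.<-cmp p′ q′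
    ... | tri< _ _ _  = trans (bandWord-band< (rotate p′) (rotate q′) _ p<q) (sym (bandWord≡a _ _ p<q))
    ... | tri≈ _ eq _ = contradiction eq p′≢q′
    ... | tri> _ _ _  = trans (bandWord-band> (rotate q′) (rotate p′) _ p<q) (sym (bandWord≡a _ _ p<q))

-- Finite sets up to double negation

infixl 1 _>>=_
_>>=_ : {A : Set ℓ₁} {B : Set ℓ₂} → ¬ ¬ A → (A → ¬ ¬ B) → ¬ ¬ B
(m >>= f) ¬b = m λ x → f x ¬b

return : {A : Set ℓ₁} → A → ¬ ¬ A
return x ¬a = ¬a x

-- Double negation commutes with a product over a finite index set; this is the only form of choice
-- used to collect cardinalities and preimages.
¬¬-Π : {P : Fin k → Set ℓ₁} → (∀ i → ¬ ¬ P i) → ¬ ¬ (∀ i → P i)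
¬¬-Π {k = ℕ.zero} p = return λ ()
¬¬-Π {k = suc k}  p =
  p zero >>= λ p₀ →
  ¬¬-Π (p ∘ suc) >>= λ ps →
  return (Fin.∀-cons p₀ ps)

module _ {Y : Setoid 0ℓ 0ℓ} where
  open Setoid Y using (Carrier; _≈_) renaming (sym to ≈-sym; trans to ≈-trans; refl to ≈-refl; reflexive to ≈-reflexive)

  mkCard : (to : Fin k → Carrier) (from : Carrier → Fin k) →
           (∀ {x y} → x ≈ y → from x ≡ from y) →
           (∀ y → to (from y) ≈ y) → (∀ i → from (to i) ≡ i) → HasCard Y k
  mkCard to from from-cong to-from from-to = record
    { to        = to
    ; from      = from
    ; to-cong   = ≈-reflexive ∘ cong to
    ; from-cong = from-cong
    ; inverse   = (λ { refl → to-from _ }) , λ y≈to → trans (from-cong y≈to) (from-to _)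
    }

  module _ (c : HasCard Y k) where
    open Inverse c

    to∘from : ∀ y → to (from y) ≈ y
    to∘from y = inverseˡ refl

    card-injective : ∀ {i j} → to i ≈ to j → i ≡ j
    card-injective {i} {j} eq = trans (sym (inverseʳ ≈-refl)) (inverseʳ eq)

    from-injective : ∀ {x y} → from x ≡ from y → x ≈ y
    from-injective {x} {y} eq =
      ≈-trans (≈-sym (to∘from x)) (≈-trans (≈-reflexive (cong to eq)) (to∘from y))

-- When the class of the element y₀ with code zero has another code, that code
-- replaces zero; otherwise this class is exactly the set of elements with code
-- zero.
finite : (Y : Setoid 0ℓ 0ℓ) (m : ℕ) (code : Setoid.Carrier Y → Fin m) →
         (∀ x y → code x ≡ code y → Setoid._≈_ Y x y) → ¬ ¬ ∃ (HasCard Y)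
finite Y ℕ.zero code inj =
  return (0 , mkCard (λ ()) code (λ {x} _ → contradiction (code x) Fin.¬Fin0)
                     (λ y → contradiction (code y) Fin.¬Fin0) λ ())
finite Y (suc m) code inj = ¬¬-excluded-middle >>= by-zero
  where
  open Setoid Y using (Carrier; _≈_) renaming (sym to ≈-sym; trans to ≈-trans; refl to ≈-refl)

  zero? : ∀ y → Dec (zero ≡ code y)
  zero? y = zero Fin.≟ code y

  by-zero : Dec (∃[ y ] code y ≡ zero) → ¬ ¬ ∃ (HasCard Y)
  by-zero (no ¬zero) = finite Y m (λ y → punchOut (≢zero y)) λ x y eq →
    inj x y (Fin.punchOut-injective (≢zero x) (≢zero y) eq)
    where
    ≢zero : ∀ y → zero ≢ code y
    ≢zero y eq = ¬zero (y , sym eq)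
  by-zero (yes (y₀ , y₀-zero)) = ¬¬-excluded-middle >>= by-other
    where
    by-other : Dec (∃[ y ] y ≈ y₀ × zero ≢ code y) → ¬ ¬ ∃ (HasCard Y)
    by-other (yes (y₁ , y₁≈y₀ , y₁-nonzero)) =
      finite Y m (λ y → recode y (zero? y)) λ x y → recode-injective x y (zero? x) (zero? y)
      where
      recode : ∀ y → Dec (zero ≡ code y) → Fin m
      recode y (yes _)      = punchOut y₁-nonzero
      recode y (no nonzero) = punchOut nonzero

      zero⇒≈y₁ : ∀ y → zero ≡ code y → y ≈ y₁
      zero⇒≈y₁ y y-zero = ≈-trans (inj y y₀ (trans (sym y-zero) (sym y₀-zero))) (≈-sym y₁≈y₀)

      recode-injective : ∀ x y dx dy → recode x dx ≡ recode y dy → x ≈ y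
      recode-injective x y (yes x0) (yes y0) eq = ≈-trans (zero⇒≈y₁ x x0) (≈-sym (zero⇒≈y₁ y y0))
      recode-injective x y (yes x0) (no ¬y0) eq =
        ≈-trans (zero⇒≈y₁ x x0) (inj y₁ y (Fin.punchOut-injective y₁-nonzero ¬y0 eq))
      recode-injective x y (no ¬x0) (yes y0) eq =
        ≈-trans (inj x y₁ (Fin.punchOut-injective ¬x0 y₁-nonzero eq)) (≈-sym (zero⇒≈y₁ y y0))
      recode-injective x y (no ¬x0) (no ¬y0) eq = inj x y (Fin.punchOut-injective ¬x0 ¬y0 eq)
    by-other (no ¬other) =
      finite Nonzero m (λ (y , nonzero) → punchOut nonzero)
        (λ (x , x≢0) (y , y≢0) eq → inj x y (Fin.punchOut-injective x≢0 y≢0 eq)) >>= λ (k , c) →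
      return (suc k , add-y₀ c)
      where
      Nonzero : Setoid 0ℓ 0ℓ
      Nonzero = Y ∣ˢ λ y → zero ≢ code y

      add-y₀ : HasCard Nonzero k → HasCard Y (suc k)
      add-y₀ {k} c = mkCard to′ (λ y → from′ y (zero? y))
        (λ {x} {y} x≈y → from′-cong x≈y (zero? x) (zero? y))
        (λ y → to′∘from′ y (zero? y)) (λ i → from′∘to′ i (zero? (to′ i)))
        where
        open Inverse c

        to′ : Fin (suc k) → Carrier
        to′ zero    = y₀
        to′ (suc i) = proj₁ (to i)

        from′ : ∀ y → Dec (zero ≡ code y) → Fin (suc k)
        from′ y (yes _)      = zero
        from′ y (no nonzero) = suc (from (y , nonzero))

        ≈-y₀ : ∀ y → zero ≡ code y → y ≈ y₀
        ≈-y₀ y y0 = inj y y₀ (trans (sym y0) (sym y₀-zero))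

        from′-cong : ∀ {x y} → x ≈ y → ∀ dx dy → from′ x dx ≡ from′ y dy
        from′-cong x≈y (yes _)  (yes _)  = refl
        from′-cong {x} {y} x≈y (yes x0) (no ¬y0) =
          contradiction (y , ≈-trans (≈-sym x≈y) (≈-y₀ x x0) , ¬y0) ¬other
        from′-cong {x} {y} x≈y (no ¬x0) (yes y0) =
          contradiction (x , ≈-trans x≈y (≈-y₀ y y0) , ¬x0) ¬other
        from′-cong x≈y (no ¬x0) (no ¬y0) = cong suc (from-cong x≈y)

        to′∘from′ : ∀ y dy → to′ (from′ y dy) ≈ y
        to′∘from′ y (yes y0) = ≈-sym (≈-y₀ y y0)
        to′∘from′ y (no ¬y0) = to∘from c (y , ¬y0)

        from′∘to′ : ∀ i d → from′ (to′ i) d ≡ i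
        from′∘to′ zero    (yes _)  = refl
        from′∘to′ zero    (no ¬y0) = contradiction (sym y₀-zero) ¬y0
        from′∘to′ (suc i) (yes y0) = contradiction y0 (proj₂ (to i))
        from′∘to′ (suc i) (no ¬y0) = cong suc (inverseʳ ≈-refl)

-- Finite codes for words

module _ {A : Set} {m : ℕ} (code : A → Fin m) (code-injective : ∀ {x y} → code x ≡ code y → x ≡ y) where

  listCode : ∀ ℓ (xs : List A) → length xs ≡ ℓ → Fin (m ^ ℓ)
  listCode ℕ.zero  []       eq = zero
  listCode (suc ℓ) (x ∷ xs) eq = combine (code x) (listCode ℓ xs (ℕ.suc-injective eq))

  listCode-injective : ∀ ℓ xs ys p q → listCode ℓ xs p ≡ listCode ℓ ys q → xs ≡ ys
  listCode-injective ℕ.zero  []       []       p q eq = refl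
  listCode-injective (suc ℓ) (x ∷ xs) (y ∷ ys) p q eq = cong₂ _∷_
    (code-injective (Fin.combine-injectiveˡ (code x) _ (code y) _ eq))
    (listCode-injective ℓ xs ys _ _ (Fin.combine-injectiveʳ (code x) _ (code y) _ eq))

genSize : Alphabet → ℕ → ℕ
genSize Σₙ  n = pred n
genSize Σₙ* n = n * n

genCode : ∀ S → Gen S n → Fin (genSize S n)
genCode Σₙ  (artin k)       = k
genCode Σₙ* a⟨ p , q , _ ⟩  = combine p q

genCode-injective : ∀ S {x y : Gen S n} → genCode S x ≡ genCode S y → x ≡ y
genCode-injective Σₙ  {artin k} {artin l} refl = refl
genCode-injective Σₙ* {a⟨ p , q , p<q ⟩} {a⟨ p′ , q′ , p′<q′ ⟩} eq
  with refl , refl ← Fin.combine-injective p q p′ q′ eq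
  = cong a⟨ p , q ,_⟩ (ℕ.<-irrelevant p<q p′<q′)

signCode : Sign → Fin 2
signCode Sign.+ = zero
signCode Sign.- = suc zero

signCode-injective : ∀ {s t} → signCode s ≡ signCode t → s ≡ t
signCode-injective {Sign.+} {Sign.+} eq = refl
signCode-injective {Sign.-} {Sign.-} eq = refl

letterCode : ∀ S → Letter (Gen S n) → Fin (genSize S n * 2)
letterCode S (x , s) = combine (genCode S x) (signCode s)

letterCode-injective : ∀ S {x y : Letter (Gen S n)} → letterCode S x ≡ letterCode S y → x ≡ y
letterCode-injective S {x , s} {y , t} eq = cong₂ _,_
  (genCode-injective S (Fin.combine-injectiveˡ (genCode S x) (signCode s) (genCode S y) (signCode t) eq))
  (signCode-injective (Fin.combine-injectiveʳ (genCode S x) (signCode s) (genCode S y) (signCode t) eq))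

-- A braid can have several shortest words, so `word` may differ on equal elements; what is asked is
-- that a word determines the class of its element.
finite-by-words : ∀ S ℓ (Y : Setoid 0ℓ 0ℓ) (word : Setoid.Carrier Y → Word (Gen S n)) →
                  (∀ y → length (word y) ≡ ℓ) →
                  (∀ x y → word x ≡ word y → Setoid._≈_ Y x y) → ¬ ¬ ∃ (HasCard Y)
finite-by-words S ℓ Y word length-word inj =
  finite Y _ (λ y → listCode (letterCode S) (letterCode-injective S) ℓ (word y) (length-word y))
    λ x y eq → inj x y (listCode-injective (letterCode S) (letterCode-injective S) ℓ _ _ _ _ eq)

minimum : {X : Set} (_≲_ : Rel X 0ℓ) → Total _≲_ → Transitive _≲_ →
          (f : Fin (suc k) → X) → ∃[ i ] ∀ j → f i ≲ f j
-- Reflexivity is extracted from totality.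
minimum {ℕ.zero} _≲_ total ≲-trans f = zero , λ { zero → [ id , id ]′ (total (f zero) (f zero)) }
minimum {suc k} _≲_ total ≲-trans f with minimum _≲_ total ≲-trans (f ∘ suc)
... | i , i-least with total (f zero) (f (suc i))
...   | inj₁ f0≲fi = zero , Fin.∀-cons ([ id , id ]′ (total (f zero) (f zero))) (λ j → ≲-trans f0≲fi (i-least j))
...   | inj₂ fi≲f0 = suc i , Fin.∀-cons fi≲f0 i-least

-- Counting a disjoint union

flatten : (f : Fin k → ℕ) → Σ (Fin k) (Fin ∘ f) → Fin (sum (tabulate f))
flatten {suc k} f (zero  , x) = x ↑ˡ sum (tabulate (f ∘ suc))
flatten {suc k} f (suc i , x) = f zero ↑ʳ flatten (f ∘ suc) (i , x)

unflatten : (f : Fin k → ℕ) → Fin (sum (tabulate f)) → Σ (Fin k) (Fin ∘ f)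
unflatten {suc k} f x = [ (zero ,_) , (λ (i , y) → suc i , y) ∘ unflatten (f ∘ suc) ]′ (splitAt (f zero) x)

unflatten-flatten : (f : Fin k → ℕ) (x : Σ (Fin k) (Fin ∘ f)) → unflatten f (flatten f x) ≡ x
unflatten-flatten {suc k} f (zero  , x)
  rewrite Fin.splitAt-↑ˡ (f zero) x (sum (tabulate (f ∘ suc))) = refl
unflatten-flatten {suc k} f (suc i , x)
  rewrite Fin.splitAt-↑ʳ (f zero) (sum (tabulate (f ∘ suc))) (flatten (f ∘ suc) (i , x))
        | unflatten-flatten (f ∘ suc) (i , x) = refl

flatten-unflatten : (f : Fin k → ℕ) (x : Fin (sum (tabulate f))) → flatten f (unflatten f x) ≡ x
flatten-unflatten {suc k} f x with splitAt (f zero) x in eq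
... | inj₁ y = Fin.splitAt⁻¹-↑ˡ eq
... | inj₂ y = trans (cong (f zero ↑ʳ_) (flatten-unflatten (f ∘ suc) y)) (Fin.splitAt⁻¹-↑ʳ eq)

-- Two injections between finite sets: a section of `F` in one direction, `F` itself in the other.
card-Σ : ∀ {s} (f : Fin k → ℕ) (F : Σ (Fin k) (Fin ∘ f) → Fin s) →
         (∀ x y → F x ≡ F y → x ≡ y) → (∀ z → ∃[ x ] F x ≡ z) → s ≡ sum (tabulate f)
card-Σ f F F-injective F-surjective = ℕ.≤-antisym
  (Fin.injective⇒≤ {f = flatten f ∘ proj₁ ∘ F-surjective} λ {x} {y} eq →
    let open ≡-Reasoning in begin
    x                                            ≡⟨ proj₂ (F-surjective x) ⟨
    F (proj₁ (F-surjective x))                   ≡⟨ cong F (flatten-injective eq) ⟩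
    F (proj₁ (F-surjective y))                   ≡⟨ proj₂ (F-surjective y) ⟩
    y                                            ∎)
  (Fin.injective⇒≤ {f = F ∘ unflatten f} λ {x} {y} eq →
    trans (sym (flatten-unflatten f x)) (trans (cong (flatten f) (F-injective _ _ eq)) (flatten-unflatten f y)))
  where
  flatten-injective : ∀ {x y} → flatten f x ≡ flatten f y → x ≡ y
  flatten-injective {x} {y} eq =
    trans (sym (unflatten-flatten f x)) (trans (cong (unflatten f) eq) (unflatten-flatten f y))

-- The order on templates

-- `_<ᵖ_` for arbitrary functions: the recursion in `colex-total` drops the point `zero`, and what
-- remains of a permutation is no longer one.
Colex : (f g : Fin k → Fin n) → Set
Colex f g = ∃[ i ] (∀ j → i Fin.< j → f j ≡ g j) × f i Fin.< g i

colex-total : (f g : Fin k → Fin n) → (∀ i → f i ≡ g i) ⊎ Colex f g ⊎ Colex g f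
colex-total {ℕ.zero} f g = inj₁ λ ()
colex-total {suc k}  f g with colex-total (f ∘ suc) (g ∘ suc)
... | inj₂ (inj₁ (i , eq , lt)) = inj₂ (inj₁ (suc i , (λ { (suc j) (s≤s i<j) → eq j i<j }) , lt))
... | inj₂ (inj₂ (i , eq , lt)) = inj₂ (inj₂ (suc i , (λ { (suc j) (s≤s i<j) → eq j i<j }) , lt))
... | inj₁ eq with Fin.<-cmp (f zero) (g zero)
...   | tri< lt _ _  = inj₂ (inj₁ (zero , (λ { (suc j) _ → eq j }) , lt))
...   | tri≈ _ eq₀ _ = inj₁ (Fin.∀-cons eq₀ eq)
...   | tri> _ _ gt  = inj₂ (inj₂ (zero , (λ { (suc j) _ → sym (eq j) }) , gt))

≈ᵖ-isEquivalence : IsEquivalence (Perm._≈_ {n} {n})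
≈ᵖ-isEquivalence {n} = Setoid.isEquivalence (permutationSetoid n)

<ᵖ-resp-≈ : _<ᵖ_ {n} Respects₂ Perm._≈_
<ᵖ-resp-≈ = (λ eq (k , above , lt) → k , (λ m k<m → trans (above m k<m) (eq m)) , subst (_ Fin.<_) (eq k) lt)
          , (λ eq (k , above , lt) → k , (λ m k<m → trans (sym (eq m)) (above m k<m)) , subst (Fin._< _) (eq k) lt)

-- The higher of the two deciding positions decides the composite.
<ᵖ-trans : Transitive (_<ᵖ_ {n})
<ᵖ-trans {n} {ρ} {ρ′} {ρ″} (k , above , lt) (k′ , above′ , lt′) with Fin.<-cmp k k′
... | tri< k<k′ _ _ = k′ , (λ m k′<m → trans (above m (ℕ.<-trans k<k′ k′<m)) (above′ m k′<m)) ,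
                      subst (Fin._< (ρ″ ⟨$⟩ʳ k′)) (sym (above k′ k<k′)) lt′
... | tri≈ _ refl _ = k , (λ m k<m → trans (above m k<m) (above′ m k<m)) , ℕ.<-trans lt lt′
... | tri> _ _ k′<k = k , (λ m k<m → trans (above m k<m) (above′ m (ℕ.<-trans k′<k k<m))) ,
                      subst ((ρ ⟨$⟩ʳ k) Fin.<_) (above′ k k′<k) lt

<ᵖ-irrefl : {ρ ρ′ : Permutation′ n} → ρ Perm.≈ ρ′ → ¬ ρ <ᵖ ρ′
<ᵖ-irrefl eq (k , _ , lt) = ℕ.<-irrefl (cong toℕ (eq k)) lt

<ᵖ-asym : Asymmetric (_<ᵖ_ {n})
<ᵖ-asym {n} {ρ} {ρ′} lt gt = <ᵖ-irrefl {ρ = ρ} {ρ} (λ _ → refl) (<ᵖ-trans {n} {ρ} {ρ′} {ρ} lt gt)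

<ᵖ-cmp : Trichotomous (Perm._≈_ {n} {n}) _<ᵖ_
<ᵖ-cmp {n} ρ ρ′ with colex-total (ρ ⟨$⟩ʳ_) (ρ′ ⟨$⟩ʳ_)
... | inj₁ eq        = tri≈ (<ᵖ-irrefl {ρ = ρ} {ρ′} eq) eq (<ᵖ-irrefl {ρ = ρ′} {ρ} (sym ∘ eq))
... | inj₂ (inj₁ lt) = tri< lt (λ eq → <ᵖ-irrefl {ρ = ρ} {ρ′} eq lt) (<ᵖ-asym {n} {ρ} {ρ′} lt)
... | inj₂ (inj₂ gt) = tri> (<ᵖ-asym {n} {ρ′} {ρ} gt) (λ eq → <ᵖ-irrefl {ρ = ρ′} {ρ} (sym ∘ eq) gt) gt

≤ᵗ-trans : Transitive (_≤ᵗ_ {n})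
≤ᵗ-trans {n} {x} {y} {z} = ×-transitive {_<₁_ = _<ᵖ_} ≈ᵖ-isEquivalence <ᵖ-resp-≈
  (λ {ρ} {ρ′} {ρ″} → <ᵖ-trans {n} {ρ} {ρ′} {ρ″})
  (Vec.≤-trans (IsEquivalence.isPartialEquivalence isEquivalence) (resp₂ ℤ._<_) ℤ.<-trans)
  {x} {y} {z}

≤ᵗ-total : Total (_≤ᵗ_ {n})
≤ᵗ-total {n} = ×-total₂ (λ {ρ} {ρ′} → IsEquivalence.sym ≈ᵖ-isEquivalence {ρ} {ρ′}) <ᵖ-cmp (Vec.≤-total sym ℤ.<-cmp)

≤ᵗ-antisym : {t t′ : Template n} → t ≤ᵗ t′ → t′ ≤ᵗ t → t ≈ᵗ t′
≤ᵗ-antisym {n} {t} {t′} = ×-antisymmetric {_<₁_ = _<ᵖ_} {_≈₂_ = _≡_}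
  (λ {ρ} {ρ′} → IsEquivalence.sym ≈ᵖ-isEquivalence {ρ} {ρ′})
  (λ {ρ} {ρ′} → <ᵖ-irrefl {ρ = ρ} {ρ′}) (λ {ρ} {ρ′} → <ᵖ-asym {n} {ρ} {ρ′})
  (λ x≤y y≤x → Pointwise.Pointwise-≡⇒≡ (Vec.≤-antisym sym ℤ.<-irrefl ℤ.<-asym x≤y y≤x))
  {t} {t′}

≤ᵗ-reflexive : {t t′ : Template n} → t ≈ᵗ t′ → t ≤ᵗ t′
≤ᵗ-reflexive (p , refl) = inj₂ (p , Vec.≤-refl (Pointwise.refl refl))

-- Symmetries of the braid group

-- The templates are explicit arguments because _≈ᵗ_ does not determine them.
≈ᵗ-refl : (t : Template n) → t ≈ᵗ t
≈ᵗ-refl {n} t = Setoid.refl (templateSetoid n) {t}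

≈ᵗ-sym : (t t′ : Template n) → t ≈ᵗ t′ → t′ ≈ᵗ t
≈ᵗ-sym {n} t t′ = Setoid.sym (templateSetoid n) {t} {t′}

≈ᵗ-trans : (t t′ t″ : Template n) → t ≈ᵗ t′ → t′ ≈ᵗ t″ → t ≈ᵗ t″
≈ᵗ-trans {n} t t′ t″ = Setoid.trans (templateSetoid n) {t} {t′} {t″}

τ-cong : {β γ : Word (Artin n)} → β ≈ᵇ γ → τ β ≈ᵗ τ γ
τ-cong = ∼⇒≈ᵗ ∘ ≈ᵇ⇒∼

expand-++ : ∀ S (u v : Word (Gen S n)) → expand S (u ++ v) ≡ expand S u ++ expand S v
expand-++ Σₙ  u v = refl
expand-++ Σₙ* u v = List.concatMap-++ _ u v

expand-⁻¹ : ∀ S (x : Letter (Gen S n)) → expand S [ x ⁻¹ ] ≡ inv (expand S [ x ])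
expand-⁻¹ Σₙ  x            = refl
expand-⁻¹ Σₙ* (a , Sign.+)
  rewrite List.++-identityʳ (bandWord a) | List.++-identityʳ (inv (bandWord a)) = refl
expand-⁻¹ Σₙ* (a , Sign.-)
  rewrite List.++-identityʳ (bandWord a) | List.++-identityʳ (inv (bandWord a)) = sym (inv-involutive (bandWord a))

expand-inv : ∀ S (u : Word (Gen S n)) → expand S (inv u) ≡ inv (expand S u)
expand-inv Σₙ  []      = refl
expand-inv Σₙ* []      = refl
expand-inv S   (x ∷ u) = begin
  expand S (inv (x ∷ u))                 ≡⟨ cong (expand S) (inv-∷ x u) ⟩
  expand S (inv u ++ [ x ⁻¹ ])           ≡⟨ expand-++ S (inv u) [ x ⁻¹ ] ⟩
  expand S (inv u) ++ expand S [ x ⁻¹ ]  ≡⟨ cong₂ _++_ (expand-inv S u) (expand-⁻¹ S x) ⟩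
  inv (expand S u) ++ inv (expand S [ x ]) ≡⟨ inv-++ (expand S [ x ]) (expand S u) ⟨
  inv (expand S [ x ] ++ expand S u)     ≡⟨ cong inv (expand-++ S [ x ] u) ⟨
  inv (expand S (x ∷ u))                 ∎
  where open ≡-Reasoning

-- What a generator of G_S provides and what survives composition and inversion. Multiplicativity is
-- not among the fields because `inv` reverses products.
record Symmetry (S : Alphabet) (n : ℕ) : Set where
  field
    to from   : Word (Artin n) → Word (Artin n)
    to-cong   : ∀ {β γ} → β ≈ᵇ γ → to β ≈ᵇ to γ
    from-cong : ∀ {β γ} → β ≈ᵇ γ → from β ≈ᵇ from γ
    to-∼      : ∀ {β γ} → β ∼ γ → to β ∼ to γ
    from-∼    : ∀ {β γ} → β ∼ γ → from β ∼ from γ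
    to-from   : ∀ β → to (from β) ≈ᵇ β
    from-to   : ∀ β → from (to β) ≈ᵇ β
    to-word   : (u : Word (Gen S n)) → ∃[ v ] expand S v ≈ᵇ to (expand S u) × length v ≡ length u
    from-word : (u : Word (Gen S n)) → ∃[ v ] expand S v ≈ᵇ from (expand S u) × length v ≡ length u

  -- `to-word` carries a shortest word forward; a shorter word for the image would be pulled back by
  -- `from-word` to a shorter word for `β`.
  to-length : ∀ {β ℓ} → HasLength S β ℓ → HasLength S (to β) ℓ
  to-length {β} {ℓ} ((u , u≈β , u-length) , shortest) with v , v≈tou , v-length ← to-word u =
    (v , ≈ᵇ.trans v≈tou (to-cong u≈β) , trans v-length u-length) , λ w w≈toβ →
      let w′ , w′≈fromw , w′-length = from-word w
      in subst (ℓ ≤_) w′-length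
           (shortest w′ (≈ᵇ.trans w′≈fromw (≈ᵇ.trans (from-cong w≈toβ) (from-to β))))

open Symmetry

reverseSymmetry : ∀ {S} → Symmetry S n → Symmetry S n
reverseSymmetry f = record
  { to        = from f      ; from      = to f
  ; to-cong   = from-cong f ; from-cong = to-cong f
  ; to-∼      = from-∼ f    ; from-∼    = to-∼ f
  ; to-from   = from-to f   ; from-to   = to-from f
  ; to-word   = from-word f ; from-word = to-word f
  }

idSymmetry : ∀ {S} → Symmetry S n
idSymmetry = record
  { to        = id         ; from      = id
  ; to-cong   = id         ; from-cong = id
  ; to-∼      = id         ; from-∼    = id
  ; to-from   = λ _ → ≈ᵇ.refl ; from-to = λ _ → ≈ᵇ.refl
  ; to-word   = λ u → u , ≈ᵇ.refl , refl
  ; from-word = λ u → u , ≈ᵇ.refl , refl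
  }

composeSymmetry : ∀ {S} → Symmetry S n → Symmetry S n → Symmetry S n
composeSymmetry f g = record
  { to        = to f ∘ to g
  ; from      = from g ∘ from f
  ; to-cong   = to-cong f ∘ to-cong g
  ; from-cong = from-cong g ∘ from-cong f
  ; to-∼      = to-∼ f ∘ to-∼ g
  ; from-∼    = from-∼ g ∘ from-∼ f
  ; to-from   = λ β → ≈ᵇ.trans (to-cong f (to-from g _)) (to-from f β)
  ; from-to   = λ β → ≈ᵇ.trans (from-cong g (from-to f _)) (from-to g β)
  ; to-word   = λ u →
      let v , v≈ , v-length = to-word g u
          w , w≈ , w-length = to-word f v
      in w , ≈ᵇ.trans w≈ (to-cong f v≈) , trans w-length v-length
  ; from-word = λ u →
      let v , v≈ , v-length = from-word f u
          w , w≈ , w-length = from-word g v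
      in w , ≈ᵇ.trans w≈ (from-cong g v≈) , trans w-length v-length
  }

invSymmetry : ∀ S → Symmetry S n
invSymmetry S = record
  { to        = inv           ; from      = inv
  ; to-cong   = Braid.inv-cong ; from-cong = Braid.inv-cong
  ; to-∼      = Strands.inv-cong ; from-∼ = Strands.inv-cong
  ; to-from   = ≈ᵇ.reflexive ∘ inv-involutive
  ; from-to   = ≈ᵇ.reflexive ∘ inv-involutive
  ; to-word   = word
  ; from-word = word
  }
  where
  word : (u : Word (Gen S n)) → ∃[ v ] expand S v ≈ᵇ inv (expand S u) × length v ≡ length u
  word u = inv u , ≈ᵇ.reflexive (expand-inv S u) , length-inv u

-- Inverting each letter amounts to inverting the reversed word. Reversal exchanges the two sides of
-- `far` and fixes both sides of `near`, which are palindromes.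
θ-relator : {l r : Word (Artin n)} → Relator l r → map _⁻¹ l ≈ᵇ map _⁻¹ r
θ-relator (cancel x)   = cancels (x ⁻¹)
θ-relator (far i j p)  = Braid.inv-cong (≈ᵇ.sym (relator (far i j p)))
θ-relator (near i j p) = Braid.inv-cong (relator (near i j p))

θSymmetry : Symmetry Σₙ n
θSymmetry = record
  { to        = map _⁻¹  ; from      = map _⁻¹
  ; to-cong   = θ-cong   ; from-cong = θ-cong
  ; to-∼      = ∼-θ-cong ; from-∼    = ∼-θ-cong
  ; to-from   = θ-θ      ; from-to   = θ-θ
  ; to-word   = λ u → map _⁻¹ u , ≈ᵇ.refl , List.length-map _⁻¹ u
  ; from-word = λ u → map _⁻¹ u , ≈ᵇ.refl , List.length-map _⁻¹ u
  }
  where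
  θ-cong : {β γ : Word (Artin n)} → β ≈ᵇ γ → map _⁻¹ β ≈ᵇ map _⁻¹ γ
  θ-cong = extend _≈ᵇ_ ≈ᵇ.isEquivalence ++-cong (map _⁻¹) (List.map-++ _⁻¹) θ-relator

  θ-θ : (β : Word (Artin n)) → map _⁻¹ (map _⁻¹ β) ≈ᵇ β
  θ-θ β = ≈ᵇ.reflexive (trans (sym (List.map-∘ β)) (trans (List.map-cong ⁻¹-involutive β) (List.map-id β)))

toℕ-opposite : (i : Fin n) → toℕ (opposite i) ℕ.+ suc (toℕ i) ≡ n
toℕ-opposite i = trans (cong (ℕ._+ suc (toℕ i)) (Fin.opposite-prop i)) (ℕ.m∸n+n≡m (Fin.toℕ<n i))

∣opposite-opposite∣ : (i j : Fin n) → ∣ toℕ (opposite i) - toℕ (opposite j) ∣ ≡ ∣ toℕ i - toℕ j ∣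
∣opposite-opposite∣ {n} i j = begin
  -- Adding `suc i′` and `suc j′` to both numbers clears the truncated subtractions hidden in
  -- `opposite`.
  ∣ x - y ∣                                  ≡⟨ ℕ.∣m+n-m+o∣≡∣n-o∣ (suc i′ ℕ.+ suc j′) x y ⟨
  ∣ suc i′ ℕ.+ suc j′ ℕ.+ x - suc i′ ℕ.+ suc j′ ℕ.+ y ∣ ≡⟨ cong₂ ∣_-_∣ left right ⟩
  ∣ n ℕ.+ suc j′ - n ℕ.+ suc i′ ∣                ≡⟨ ℕ.∣m+n-m+o∣≡∣n-o∣ n (suc j′) (suc i′) ⟩
  ∣ j′ - i′ ∣                                ≡⟨ ℕ.∣-∣-comm j′ i′ ⟩
  ∣ i′ - j′ ∣                                ∎
  where
  open ≡-Reasoning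
  x  = toℕ (opposite i)
  y  = toℕ (opposite j)
  i′ = toℕ i
  j′ = toℕ j

  left : suc i′ ℕ.+ suc j′ ℕ.+ x ≡ n ℕ.+ suc j′
  left = trans (rearrange (suc i′) (suc j′) x) (cong (ℕ._+ suc j′) (toℕ-opposite i))
    where
    rearrange : ∀ a b c → a ℕ.+ b ℕ.+ c ≡ c ℕ.+ a ℕ.+ b
    rearrange a b c = trans (ℕ.+-comm (a ℕ.+ b) c) (sym (ℕ.+-assoc c a b))

  right : suc i′ ℕ.+ suc j′ ℕ.+ y ≡ n ℕ.+ suc i′
  right = begin
    suc i′ ℕ.+ suc j′ ℕ.+ y    ≡⟨ ℕ.+-assoc (suc i′) (suc j′) y ⟩
    suc i′ ℕ.+ (suc j′ ℕ.+ y)  ≡⟨ cong (suc i′ ℕ.+_) (trans (ℕ.+-comm (suc j′) y) (toℕ-opposite j)) ⟩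
    suc i′ ℕ.+ n             ≡⟨ ℕ.+-comm (suc i′) n ⟩
    n ℕ.+ suc i′             ∎

Φ-relator : {l r : Word (Artin n)} → Relator l r → Φ l ≈ᵇ Φ r
Φ-relator (cancel (k , s)) = cancels (flipArtin k , s)
Φ-relator (far i j p)  = relator (far (opposite i) (opposite j) (subst (2 ≤_) (sym (∣opposite-opposite∣ i j)) p))
Φ-relator (near i j p) = relator (near (opposite i) (opposite j) (trans (∣opposite-opposite∣ i j) p))

ΦSymmetry : Symmetry Σₙ n
ΦSymmetry = record
  { to        = Φ        ; from      = Φ
  ; to-cong   = Φ-cong   ; from-cong = Φ-cong
  ; to-∼      = ∼-Φ-cong ; from-∼    = ∼-Φ-cong
  ; to-from   = Φ-Φ      ; from-to   = Φ-Φ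
  ; to-word   = λ u → Φ u , ≈ᵇ.refl , List.length-map _ u
  ; from-word = λ u → Φ u , ≈ᵇ.refl , List.length-map _ u
  }
  where
  Φ-cong : {β γ : Word (Artin n)} → β ≈ᵇ γ → Φ β ≈ᵇ Φ γ
  Φ-cong = extend _≈ᵇ_ ≈ᵇ.isEquivalence ++-cong Φ (List.map-++ _) Φ-relator

  flip-flip : (x : Letter (Artin n)) → (flipArtin (flipArtin (proj₁ x)) , proj₂ x) ≡ x
  flip-flip (artin k , s) = cong (λ k → artin k , s) (Fin.opposite-involutive k)

  Φ-Φ : (β : Word (Artin n)) → Φ (Φ β) ≈ᵇ β
  Φ-Φ β = ≈ᵇ.reflexive (trans (sym (List.map-∘ β)) (trans (List.map-cong flip-flip β) (List.map-id β)))

module _ {n : ℕ} where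
  open Conjugation (Braid.group {n}) public
    using (_▷_; ▷-congˡ; ▷-∙; ▷-⁻¹; ▷-ε; ▷-action; ▷-cong; ▷-identityˡ)

bandWord-rotate : (x : Band n) → bandWord (rotateBand x) ≈ᵇ δ ▷ bandWord x
bandWord-rotate {ℕ.zero} a⟨ () , _ , _ ⟩
bandWord-rotate {suc m}  x = Rotation.bandWord-rotateBand m x

bandWord-rotate⁻¹ : (x : Band n) → ∃[ y ] bandWord (rotateBand y) ≡ bandWord x
bandWord-rotate⁻¹ {ℕ.zero} a⟨ () , _ , _ ⟩
bandWord-rotate⁻¹ {suc m}  x = Rotation.rotateBand-surjective m x

φ : Word (Band n) → Word (Band n)
φ = letterwise rotateBand

expand-φ : (u : Word (Band n)) → expand Σₙ* (φ u) ≈ᵇ δ ▷ expand Σₙ* u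
expand-φ []            = ≈ᵇ.sym (▷-ε δ)
expand-φ {n} ((x , s) ∷ u) = begin
  expand Σₙ* (φ ((x , s) ∷ u))                          ≡⟨ expand-++ Σₙ* (φ [ x , s ]) (φ u) ⟩
  expand Σₙ* (φ [ x , s ]) ++ expand Σₙ* (φ u)          ≈⟨ ++-cong (letter s) (expand-φ u) ⟩
  (δ ▷ expand Σₙ* [ x , s ]) ++ (δ ▷ expand Σₙ* u)      ≈⟨ ▷-∙ δ (expand Σₙ* [ x , s ]) (expand Σₙ* u) ⟨
  δ ▷ (expand Σₙ* [ x , s ] ++ expand Σₙ* u)            ≡⟨ cong (δ ▷_) (expand-++ Σₙ* [ x , s ] u) ⟨
  δ ▷ expand Σₙ* ((x , s) ∷ u)                          ∎
  where
  open SetoidReasoning (braidSetoid n)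

  letter : ∀ s → expand Σₙ* (φ [ x , s ]) ≈ᵇ δ ▷ expand Σₙ* [ x , s ]
  letter Sign.+ = begin
    bandWord (rotateBand x) ++ []  ≡⟨ List.++-identityʳ _ ⟩
    bandWord (rotateBand x)        ≈⟨ bandWord-rotate x ⟩
    δ ▷ bandWord x                 ≡⟨ cong (δ ▷_) (List.++-identityʳ (bandWord x)) ⟨
    δ ▷ (bandWord x ++ [])         ∎
  letter Sign.- = begin
    inv (bandWord (rotateBand x)) ++ []  ≡⟨ List.++-identityʳ _ ⟩
    inv (bandWord (rotateBand x))        ≈⟨ Braid.inv-cong (bandWord-rotate x) ⟩
    inv (δ ▷ bandWord x)                 ≈⟨ ▷-⁻¹ δ (bandWord x) ⟨
    δ ▷ inv (bandWord x)                 ≡⟨ cong (δ ▷_) (List.++-identityʳ (inv (bandWord x))) ⟨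
    δ ▷ (inv (bandWord x) ++ [])         ∎

-- Supplies `from-word` for conjugation by δ: a word of the same length is found letter by letter,
-- without an explicit inverse of `rotateBand`.
φ-surjective : (u : Word (Band n)) → ∃[ v ] expand Σₙ* (φ v) ≡ expand Σₙ* u × length v ≡ length u
φ-surjective []            = [] , refl , refl
φ-surjective ((x , s) ∷ u) =
  let y , y-rotated        = bandWord-rotate⁻¹ x
      v , v-rotated , |v|  = φ-surjective u
  in (y , s) ∷ v ,
     trans (expand-++ Σₙ* (φ [ y , s ]) (φ v))
       (trans (cong₂ _++_ (letter y y-rotated s) v-rotated) (sym (expand-++ Σₙ* [ x , s ] u))) ,
     cong suc |v|
  where
  letter : ∀ y → bandWord (rotateBand y) ≡ bandWord x → ∀ s →
           expand Σₙ* (φ [ y , s ]) ≡ expand Σₙ* [ x , s ]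
  letter y eq Sign.+ = cong (_++ []) eq
  letter y eq Sign.- = cong (λ w → inv w ++ []) eq

▷-inverse : (x y z : Word (Artin n)) → (x ++ y) ≈ᵇ [] → x ▷ y ▷ z ≈ᵇ z
▷-inverse x y z xy≈ε =
  ≈ᵇ.trans (≈ᵇ.sym (▷-action x y z)) (≈ᵇ.trans (▷-cong xy≈ε ≈ᵇ.refl) (▷-identityˡ z))

φSymmetry : Symmetry Σₙ* n
φSymmetry {n} = record
  { to        = δ ▷_       ; from      = inv δ ▷_
  ; to-cong   = ▷-congˡ δ  ; from-cong = ▷-congˡ (inv δ)
  ; to-∼      = λ {β} {γ} → conj-∼ δ {β} {γ} ; from-∼ = λ {β} {γ} → conj-∼ (inv δ) {β} {γ}
  ; to-from   = λ β → ▷-inverse δ (inv δ) β (Braid.inverseʳ δ)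
  ; from-to   = δ⁻¹▷δ▷
  ; to-word   = λ u → φ u , expand-φ u , List.length-map _ u
  ; from-word = λ u →
      let v , φv≡u , |v| = φ-surjective u
      in v , ≈ᵇ.trans (≈ᵇ.sym (δ⁻¹▷δ▷ (expand Σₙ* v)))
               (▷-congˡ (inv δ) (≈ᵇ.trans (≈ᵇ.sym (expand-φ v)) (≈ᵇ.reflexive φv≡u))) , |v|
  }
  where
  conj-∼ : ∀ (w : Word (Artin n)) {β γ} → β ∼ γ → (w ▷ β) ∼ (w ▷ γ)
  conj-∼ w β∼γ = ∼-++-cong (∼-refl {w}) (∼-++-cong β∼γ (∼-refl {inv w}))
    where
    ∼-refl : ∀ {u : Word (Artin n)} → u ∼ u
    ∼-refl = ≈ᵇ⇒∼ ≈ᵇ.refl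

  δ⁻¹▷δ▷ : (β : Word (Artin n)) → inv δ ▷ δ ▷ β ≈ᵇ β
  δ⁻¹▷δ▷ β = ▷-inverse (inv δ) δ β (Braid.inverseˡ δ)

-- The action lifted to braids

symmetry : ∀ {S} → WordMap S → Symmetry S n
symmetry {S = S} invᵂ = invSymmetry S
symmetry θᵂ           = θSymmetry
symmetry Φᵂ           = ΦSymmetry
symmetry φᵂ           = φSymmetry

expand-apply : ∀ {S} (μ : WordMap S) (u : Word (Gen S n)) →
               expand S (apply μ u) ≈ᵇ to (symmetry μ) (expand S u)
expand-apply {S = S} invᵂ u = ≈ᵇ.reflexive (expand-inv S u)
expand-apply θᵂ           u = ≈ᵇ.refl
expand-apply Φᵂ           u = ≈ᵇ.refl
expand-apply φᵂ           u = expand-φ u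

act : ∀ {S} → G S → Symmetry S n
act (gen μ) = symmetry μ
act one     = idSymmetry
act (g ∙ h) = composeSymmetry (act g) (act h)
act (g ⁻¹ᴳ) = reverseSymmetry (act g)

to-≈ᵗ : ∀ {S} (f : Symmetry S n) (β γ : Word (Artin n)) → τ β ≈ᵗ τ γ → τ (to f β) ≈ᵗ τ (to f γ)
to-≈ᵗ f β γ = ∼⇒≈ᵗ ∘ to-∼ f ∘ ≈ᵗ⇒∼ {u = β} {γ}

-- For a generator, the graph supplies some word `u` over `t`; since symmetries respect equality of
-- templates, `β` may replace it. The companion for `from` is proved simultaneously because formal
-- inverses exchange the two.
act-graph : ∀ {S} (g : G S) (t t′ : Template n) (β : Word (Artin n)) →
            ⟦ g ⟧ t t′ → τ β ≈ᵗ t → τ (to (act g) β) ≈ᵗ t′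
act-graph⁻¹ : ∀ {S} (g : G S) (t t′ : Template n) (β : Word (Artin n)) →
              ⟦ g ⟧ t t′ → τ β ≈ᵗ t′ → τ (from (act g) β) ≈ᵗ t
act-graph {S = S} (gen μ) t t′ β (u , τu≈t , τμu≈t′) τβ≈t = begin
  τ (to (symmetry μ) β)             ≈⟨ to-≈ᵗ (symmetry μ) β (expand S u) (≈ᵗ-trans (τ β) t (τ (expand S u)) τβ≈t (≈ᵗ-sym (τ (expand S u)) t τu≈t)) ⟩
  τ (to (symmetry μ) (expand S u))  ≈⟨ τ-cong (expand-apply μ u) ⟨
  τ (expand S (apply μ u))          ≈⟨ τμu≈t′ ⟩
  t′                                ∎
  where open SetoidReasoning (templateSetoid _)
act-graph one     t t′ β (_ , t≈t′)     τβ≈t = ≈ᵗ-trans (τ β) t t′ τβ≈t t≈t′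
act-graph (g ∙ h) t t′ β (t″ , ht , gt) τβ≈t = act-graph g t″ t′ _ gt (act-graph h t t″ β ht τβ≈t)
act-graph (g ⁻¹ᴳ) t t′ β gt             τβ≈t = act-graph⁻¹ g t′ t β gt τβ≈t
act-graph⁻¹ {S = S} (gen μ) t t′ β (u , τu≈t , τμu≈t′) τβ≈t′ = begin
  τ (from f β)                      ≈⟨ to-≈ᵗ (reverseSymmetry f) β v (≈ᵗ-trans (τ β) t′ (τ v) τβ≈t′ (≈ᵗ-sym (τ v) t′ τμu≈t′)) ⟩
  τ (from f v)                      ≈⟨ τ-cong (from-cong f (expand-apply μ u)) ⟩
  τ (from f (to f (expand S u)))    ≈⟨ τ-cong (from-to f (expand S u)) ⟩
  τ (expand S u)                    ≈⟨ τu≈t ⟩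
  t                                 ∎
  where
  open SetoidReasoning (templateSetoid _)
  f = symmetry μ
  v = expand S (apply μ u)
act-graph⁻¹ one     t t′ β (_ , t≈t′)     τβ≈t′ = ≈ᵗ-trans (τ β) t′ t τβ≈t′ (≈ᵗ-sym t t′ t≈t′)
act-graph⁻¹ (g ∙ h) t t′ β (t″ , ht , gt) τβ≈t′ = act-graph⁻¹ h t t″ _ ht (act-graph⁻¹ g t″ t′ β gt τβ≈t′)
act-graph⁻¹ (g ⁻¹ᴳ) t t′ β gt             τβ≈t′ = act-graph g t′ t β gt τβ≈t′

⟦⟧-resp : ∀ {S} (g : G S) (t t′ s s′ : Template n) → t ≈ᵗ s → t′ ≈ᵗ s′ → ⟦ g ⟧ t t′ → ⟦ g ⟧ s s′
⟦⟧-resp {S = S} (gen μ) t t′ s s′ t≈s t′≈s′ (u , p , q) =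
  u , ≈ᵗ-trans (τ (expand S u)) t s p t≈s , ≈ᵗ-trans (τ (expand S (apply μ u))) t′ s′ q t′≈s′
⟦⟧-resp one     t t′ s s′ t≈s t′≈s′ ((u , p) , q) =
  (u , ≈ᵗ-trans (τ u) t s p t≈s) , ≈ᵗ-trans s t s′ (≈ᵗ-sym t s t≈s) (≈ᵗ-trans t t′ s′ q t′≈s′)
⟦⟧-resp (g ∙ h) t t′ s s′ t≈s t′≈s′ (t″ , ht , gt) =
  t″ , ⟦⟧-resp h t t″ s t″ t≈s (≈ᵗ-refl t″) ht , ⟦⟧-resp g t″ t′ t″ s′ (≈ᵗ-refl t″) t′≈s′ gt
⟦⟧-resp (g ⁻¹ᴳ) t t′ s s′ t≈s t′≈s′ gt = ⟦⟧-resp g t′ t s′ s t′≈s′ t≈s gt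

-- Orbits, their finiteness and reduced templates

module _ {S : Alphabet} where

  Orbit-resp : (t t′ s s′ : Template n) → t ≈ᵗ s → t′ ≈ᵗ s′ → Orbit S t t′ → Orbit S s s′
  Orbit-resp t t′ s s′ t≈s t′≈s′ (g , gt) = g , ⟦⟧-resp g t t′ s s′ t≈s t′≈s′ gt

  Orbit-refl : (t : Template n) → InT t → Orbit S t t
  Orbit-refl t t∈T = one , t∈T , ≈ᵗ-refl t

  Orbit-sym : {t t′ : Template n} → Orbit S t t′ → Orbit S t′ t
  Orbit-sym (g , gt) = g ⁻¹ᴳ , gt

  Orbit-trans : {t t′ t″ : Template n} → Orbit S t t′ → Orbit S t′ t″ → Orbit S t t″
  Orbit-trans (g , gt) (h , ht) = h ∙ g , _ , gt , ht

  module _ {ℓ : ℕ} where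

    Orbit-preserves-length : (t t′ : Template n) → InTOfLength S ℓ t → Orbit S t t′ → InTOfLength S ℓ t′
    Orbit-preserves-length t t′ (β , |β| , τβ≈t) (g , gt) =
      to (act g) β , to-length (act g) |β| , act-graph g t t′ β gt τβ≈t

    shortestWord : {β : Word (Artin n)} → HasLength S β ℓ → Word (Gen S n)
    shortestWord ((u , _) , _) = u

    length-shortestWord : {β : Word (Artin n)} (|β| : HasLength S β ℓ) → length (shortestWord |β|) ≡ ℓ
    length-shortestWord ((_ , _ , |u|) , _) = |u|

    shortestWord-injective : {β γ : Word (Artin n)} (|β| : HasLength S β ℓ) (|γ| : HasLength S γ ℓ) →
                             shortestWord |β| ≡ shortestWord |γ| → β ≈ᵇ γ
    shortestWord-injective ((_ , u≈β , _) , _) ((_ , u≈γ , _) , _) refl = ≈ᵇ.trans (≈ᵇ.sym u≈β) u≈γ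

    templateWord : (t : Template n) → InTOfLength S ℓ t → Word (Gen S n)
    templateWord t (_ , |β| , _) = shortestWord |β|

    templateWord-injective : (t t′ : Template n) (p : InTOfLength S ℓ t) (p′ : InTOfLength S ℓ t′) →
                             templateWord t p ≡ templateWord t′ p′ → t ≈ᵗ t′
    templateWord-injective t t′ (β , |β| , τβ≈t) (γ , |γ| , τγ≈t′) eq =
      ≈ᵗ-trans t (τ β) t′ (≈ᵗ-sym (τ β) t τβ≈t)
        (≈ᵗ-trans (τ β) (τ γ) t′ (τ-cong (shortestWord-injective |β| |γ| eq)) τγ≈t′)

    -- A template is coded by a shortest word of some braid that realises it.
    finite-templates : (P : Template n → Set) → (∀ t → P t → InTOfLength S ℓ t) →
                       ¬ ¬ ∃ (HasCard (templateSetoid n ∣ˢ P))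
    finite-templates P P⇒T = finite-by-words S ℓ (templateSetoid _ ∣ˢ P)
      (λ (t , p) → templateWord t (P⇒T t p))
      (λ (t , p) → length-shortestWord (proj₁ (proj₂ (P⇒T t p))))
      (λ (t , p) (t′ , p′) eq → templateWord-injective t t′ (P⇒T t p) (P⇒T t′ p′) eq)

    finite-braids : (P : Word (Artin n) → Set) → (∀ {β} → P β → HasLength S β ℓ) →
                    ¬ ¬ ∃ (HasCard (braidSetoid n ∣ˢ P))
    finite-braids P P⇒length = finite-by-words S ℓ (braidSetoid _ ∣ˢ P)
      (λ (_ , p) → shortestWord (P⇒length p))
      (λ (_ , p) → length-shortestWord (P⇒length p))
      (λ (_ , p) (_ , p′) eq → shortestWord-injective (P⇒length p) (P⇒length p′) eq)

    finite-orbit : (t : Template n) → InTOfLength S ℓ t → ¬ ¬ ∃ (HasCard (orbit n S t))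
    finite-orbit t t∈T = finite-templates (Orbit S t) (λ t′ → Orbit-preserves-length t t′ t∈T)

    -- A finite nonempty orbit has a minimum in a total order; the double negation is that of the
    -- orbit's finiteness.
    red-exists : (t : Template n) → InTOfLength S ℓ t → ¬ ¬ ∃ (IsRed S t)
    red-exists {n} t t∈T@(β , _ , τβ≈t) = finite-orbit t t∈T >>= λ (k , c) → return (least k c)
      where
      least : ∀ k → HasCard (orbit n S t) k → ∃ (IsRed S t)
      least ℕ.zero  c = contradiction (Inverse.from c (t , Orbit-refl t (β , τβ≈t))) Fin.¬Fin0
      least (suc k) c
        with i , i-least ← minimum _≤ᵗ_ ≤ᵗ-total (λ {x} {y} {z} → ≤ᵗ-trans {n} {x} {y} {z}) (proj₁ ∘ Inverse.to c)
        = proj₁ (Inverse.to c i) , proj₂ (Inverse.to c i) , λ t′ t′∈orbit →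
          ≤ᵗ-trans {n} {proj₁ (Inverse.to c i)} {proj₁ (Inverse.to c (Inverse.from c (t′ , t′∈orbit)))} {t′} (i-least (Inverse.from c (t′ , t′∈orbit)))
            (≤ᵗ-reflexive {n} {proj₁ (Inverse.to c (Inverse.from c (t′ , t′∈orbit)))} {t′} (to∘from c (t′ , t′∈orbit)))

    red⇒Reduced : (t r : Template n) → InTOfLength S ℓ t → IsRed S t r → Reduced S r
    red⇒Reduced t r t∈T (r∈orbit , r-least) =
      (let γ , _ , τγ≈r = Orbit-preserves-length t r t∈T r∈orbit in Orbit-refl r (γ , τγ≈r)) ,
      λ t′ t′∈orbit → r-least t′ (Orbit-trans r∈orbit t′∈orbit)

Reduced-unique : ∀ {S} (r r′ : Template n) → Reduced S r → Reduced S r′ → Orbit S r r′ → r ≈ᵗ r′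
Reduced-unique r r′ (_ , r-least) (_ , r′-least) r′∈orbit =
  ≤ᵗ-antisym {t = r} {r′} (r-least _ r′∈orbit) (r′-least _ (Orbit-sym r′∈orbit))

cardinalities : (n : ℕ) (S : Alphabet) (ℓ : ℕ) → ¬ ¬ Cardinalities n S ℓ
cardinalities n S ℓ =
  finite-braids {S} {ℓ} (λ β → HasLength S β ℓ) id >>= λ (_ , s-card) →
  finite-templates {S} {ℓ} (λ t → Reduced S t × InTOfLength S ℓ t) (λ _ → proj₂) >>= λ (r , r-card) →
  (¬¬-Π λ i → finite-braids {S} {ℓ} (λ β → HasLength S β ℓ × τ β ≈ᵗ proj₁ (Inverse.to r-card i)) proj₁) >>= λ b-cards →
  (¬¬-Π λ i → finite-orbit {S} {ℓ} (proj₁ (Inverse.to r-card i)) (proj₂ (proj₂ (Inverse.to r-card i)))) >>= λ o-cards →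
  return record
    { s-card = s-card
    ; r-card = r-card
    ; b      = proj₁ ∘ b-cards
    ; b-card = proj₂ ∘ b-cards
    ; o      = proj₁ ∘ o-cards
    ; o-card = proj₂ ∘ o-cards
    }

-- The counting formula

module Count {n S ℓ} (C : Cardinalities n S ℓ) where
  open Cardinalities C

  private
    module R   = Inverse r-card
    module S   = Inverse s-card
    module B i = Inverse (b-card i)
    module O i = Inverse (o-card i)

  -- The group element is the witness stored at the orbit point `O.to i j`. It is the same for all
  -- `k`, so for fixed `i` and `j` this is the restriction of a single bijection of braids.
  transport : (i : Fin r) → Fin (b i) → Fin (o i) → Setoid.Carrier (braidsOfLength n S ℓ)
  transport i k j with B.to i k | O.to i j
  ... | β , |β| , _ | _ , g , _ = to (act g) β , to-length (act g) |β|

  template-transport : ∀ i k j → τ (proj₁ (transport i k j)) ≈ᵗ proj₁ (O.to i j)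
  template-transport i k j with B.to i k | O.to i j
  ... | β , _ , τβ≈red | t , g , gt = act-graph g (red i) t β gt τβ≈red

  transport-injective : ∀ i k k′ j → proj₁ (transport i k j) ≈ᵇ proj₁ (transport i k′ j) → k ≡ k′
  transport-injective i k k′ j eq = card-injective (b-card i)
    (≈ᵇ.trans (≈ᵇ.sym (from-to f _)) (≈ᵇ.trans (from-cong f eq) (from-to f _)))
    where f = act (proj₁ (proj₂ (O.to i j)))

  Index : Set
  Index = Σ[ i ∈ Fin r ] Fin (b i) × Fin (o i)

  braidIndex : Index → Fin s
  braidIndex (i , k , j) = S.from (transport i k j)

  same-template : ∀ i k j i′ k′ j′ → braidIndex (i , k , j) ≡ braidIndex (i′ , k′ , j′) →
                  proj₁ (O.to i j) ≈ᵗ proj₁ (O.to i′ j′)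
  same-template i k j i′ k′ j′ eq = begin
    proj₁ (O.to i j)                   ≈⟨ template-transport i k j ⟨
    τ (proj₁ (transport i k j))        ≈⟨ τ-cong (from-injective s-card eq) ⟩
    τ (proj₁ (transport i′ k′ j′))     ≈⟨ template-transport i′ k′ j′ ⟩
    proj₁ (O.to i′ j′)                 ∎
    where open SetoidReasoning (templateSetoid n)

  same-red : ∀ i k j i′ k′ j′ → braidIndex (i , k , j) ≡ braidIndex (i′ , k′ , j′) → i ≡ i′
  same-red i k j i′ k′ j′ eq = card-injective r-card (Reduced-unique (red i) (red i′)
    (proj₁ (proj₂ (R.to i))) (proj₁ (proj₂ (R.to i′)))
    (Orbit-trans (proj₂ (O.to i j))
      (Orbit-sym (Orbit-resp (red i′) (proj₁ (O.to i′ j′)) (red i′) (proj₁ (O.to i j)) (≈ᵗ-refl (red i′))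
        (≈ᵗ-sym (proj₁ (O.to i j)) (proj₁ (O.to i′ j′)) (same-template i k j i′ k′ j′ eq)) (proj₂ (O.to i′ j′))))))

  -- The image braid has a template; its orbit gives the reduced template `i`, the template itself
  -- then gives `j`, and once both are fixed so is the group element, which is undone to recover
  -- `k`.
  braidIndex-injective : ∀ x y → braidIndex x ≡ braidIndex y → x ≡ y
  braidIndex-injective (i , k , j) (i′ , k′ , j′) eq with refl ← same-red i k j i′ k′ j′ eq
    with refl ← card-injective (o-card i) (same-template i k j i k′ j′ eq) =
    cong (λ k → i , k , j) (transport-injective i k k′ j (from-injective s-card eq))

  braidIndex-surjective : ∀ z → ¬ ¬ (∃[ x ] braidIndex x ≡ z)
  braidIndex-surjective z with S.to z in z-braid
  ... | β , |β| = red-exists {S} {ℓ} (τ β) (β , |β| , ≈ᵗ-refl (τ β)) >>= λ (t , t-red) → return (preimage t t-red)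
    where
    preimage : ∀ t → IsRed S (τ β) t → ∃[ x ] braidIndex x ≡ z
    preimage t t-red@(t∈orbit , _) = (i , l , j) , (begin
      S.from (transport i l j)   ≡⟨ S.from-cong transport≈β ⟩
      S.from (β , |β|)           ≡⟨ cong S.from z-braid ⟨
      S.from (S.to z)            ≡⟨ S.inverseʳ ≈ᵇ.refl ⟩
      z                          ∎)
      where
      open ≡-Reasoning
      τβ∈T : InTOfLength S ℓ (τ β)
      τβ∈T = β , |β| , ≈ᵗ-refl (τ β)

      reduced : Setoid.Carrier (reducedTemplates n S ℓ)
      reduced = t , red⇒Reduced (τ β) t τβ∈T t-red , Orbit-preserves-length (τ β) t τβ∈T t∈orbit

      i = R.from reduced

      red≈t : red i ≈ᵗ t
      red≈t = to∘from r-card reduced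

      inOrbit : Setoid.Carrier (orbit n S (red i))
      inOrbit = τ β , Orbit-resp t (τ β) (red i) (τ β) (≈ᵗ-sym (red i) t red≈t) (≈ᵗ-refl (τ β)) (Orbit-sym t∈orbit)

      j = O.from i inOrbit
      -- Read off from the enumerated point, not from `inOrbit`: the two agree as templates but may
      -- carry different group elements, and `transport` uses this one.
      g = proj₁ (proj₂ (O.to i j))
      f = act g

      source : Setoid.Carrier (braidsWithTemplate n S ℓ (red i))
      source = from f β , to-length (reverseSymmetry f) |β| ,
        act-graph⁻¹ g (red i) (proj₁ (O.to i j)) β (proj₂ (proj₂ (O.to i j)))
          (≈ᵗ-sym (proj₁ (O.to i j)) (τ β) (to∘from (o-card i) inOrbit))

      l = B.from i source

      transport≈β : proj₁ (transport i l j) ≈ᵇ β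
      transport≈β = ≈ᵇ.trans (to-cong f (to∘from (b-card i) source)) (to-from f β)

  fromProduct : Σ[ i ∈ Fin r ] Fin (b i * o i) → Index
  fromProduct (i , x) = i , Fin.remQuot (o i) x

  toProduct : Index → Σ[ i ∈ Fin r ] Fin (b i * o i)
  toProduct (i , k , j) = i , Fin.combine k j

  toProduct-fromProduct : ∀ x → toProduct (fromProduct x) ≡ x
  toProduct-fromProduct (i , x) = cong (i ,_) (Fin.combine-remQuot {b i} (o i) x)

  fromProduct-toProduct : ∀ x → fromProduct (toProduct x) ≡ x
  fromProduct-toProduct (i , k , j) = cong (i ,_) (Fin.remQuot-combine k j)

  count : s ≡ sum (tabulate λ i → b i * o i)
  -- Each `z` has a preimage only up to double negation; as there are finitely many `z`, all
  -- preimages can be assumed at once.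
  count = decidable-stable (s ℕ.≟ _) (¬¬-Π braidIndex-surjective >>= λ braidIndex-preimage → return (card-Σ
    (λ i → b i * o i)
    (braidIndex ∘ fromProduct)
    (λ x y eq → trans (sym (toProduct-fromProduct x))
      (trans (cong toProduct (braidIndex-injective _ _ eq)) (toProduct-fromProduct y)))
    (λ z → toProduct (proj₁ (braidIndex-preimage z)) ,
      trans (cong braidIndex (fromProduct-toProduct _)) (proj₂ (braidIndex-preimage z)))))

-- The first component keeps the second from being vacuous: the formula is stated for any given
-- enumerations, and such enumerations cannot fail to exist.
corollary5p21 : (n : ℕ) → n ≥ 2 → (S : Alphabet) (ℓ : ℕ) →
    ¬ ¬ Cardinalities n S ℓ
    × ((C : Cardinalities n S ℓ) → let open Cardinalities C in
    s ≡ sum (tabulate (λ i → b i * o i)))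
corollary5p21 n _ S ℓ = cardinalities n S ℓ , Count.count
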